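{- $\ker\overline{\psi}\subset y\mathfrak{H}\mathbin{\widetilde{\sqcup\!\sqcup}} y\mathfrak{H}$.
   Context: Let $\mathfrak{H}=\mathbb{Q}\langle x,y\rangle$, $z_k=yx^{k-1}$, $\mathfrak{H}^1=\mathbb{Q}+y\mathfrak{H}$. The shuffle product $\mathbin{\sqcup\!\sqcup}$ on $\mathfrak{H}$ is given by $1\mathbin{\sqcup\!\sqcup} w=w\mathbin{\sqcup\!\sqcup} 1=w$, $au\mathbin{\sqcup\!\sqcup} bv=a(u\mathbin{\sqcup\!\sqcup} bv)+b(au\mathbin{\sqcup\!\sqcup} v)$ for letters $a,b\in\{x,y\}$. For $m\ge0$, $\sigma_m\colon\mathfrak{H}^1\to\mathfrak{H}^1$ is linear with $\sigma_m(1)=\delta_{m,0}$, $\sigma_m(yw)=y(w\mathbin{\sqcup\!\sqcup} x^m)$. Define the bilinear product $\mathbin{\widetilde{\sqcup\!\sqcup}}$ on $\mathfrak{H}^1$ by $1\mathbin{\widetilde{\sqcup\!\sqcup}} u=u\mathbin{\widetilde{\sqcup\!\sqcup}} 1=u$, $z_ku\mathbin{\widetilde{\sqcup\!\sqcup}} z_lv=z_k(u\mathbin{\widetilde{\sqcup\!\sqcup}} z_lv)+z_l(z_ku\mathbin{\widetilde{\sqcup\!\sqcup}} v)$; $y\mathfrak{H}\mathbin{\widetilde{\sqcup\!\sqcup}} y\mathfrak{H}$ denotes the $\mathbb{Q}$-span of $\{u\mathbin{\widetilde{\sqcup\!\sqcup}} v\mid u,v\in y\mathfrak{H}\}$. The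 linear map $\overline{\psi}\colon y\mathfrak{H}\to y\mathfrak{H}$ is $\overline{\psi}(z_{k_1}\cdots z_{k_r})=\sum_{i=0}^{r-1}(-1)^{r-i}z_{k_1}\cdots z_{k_i}\mathbin{\widetilde{\sqcup\!\sqcup}}\sigma_1(z_{k_r}\cdots z_{k_{i+1}})$. -}

module Defs where

open import Data.Nat using (ℕ; zero; suc; _∸_)
open import Data.Rational using (ℚ; 0ℚ; 1ℚ; _+_; _*_; -_)
open import Data.List using (List; []; _∷_; _++_; map; concatMap; replicate; take; drop; reverse; length; upTo; foldr)
open import Data.List.Relation.Unary.All using (All)
open import Data.Product using (_×_; _,_; proj₁; proj₂; ∃)
open import Relation.Binary.PropositionalEquality using (_≡_; refl)
open import Relation.Nullary using (yes; no; Dec; ¬_)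
import Data.List.Properties as LP

data Letter : Set where
  x y : Letter

_≟L_ : (a b : Letter) → Dec (a ≡ b)
x ≟L x = yes refl
x ≟L y = no (λ ())
y ≟L x = no (λ ())
y ≟L y = yes refl

Word : Set
Word = List Letter

_≟W_ : (u v : Word) → Dec (u ≡ v)
_≟W_ = LP.≡-dec _≟L_

-- Elements of 𝔥 as finite formal ℚ-linear combinations of words.
Poly : Set
Poly = List (ℚ × Word)

coeff : Word → Poly → ℚ
coeff w [] = 0ℚ
coeff w ((c , v) ∷ p) with v ≟W w
... | yes _ = c + coeff w p
... | no  _ = coeff w p

infix 4 _≈P_
_≈P_ : Poly → Poly → Set
p ≈P q = ∀ w → coeff w p ≡ coeff w q

zeroP : Poly
zeroP = []

oneW : Word → Poly
oneW w = (1ℚ , w) ∷ []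

scale : ℚ → Poly → Poly
scale c = map (λ { (d , w) → (c * d , w) })

prefix : Word → Poly → Poly
prefix u = map (λ { (d , w) → (d , u ++ w) })

linExt : (Word → Poly) → Poly → Poly
linExt f = concatMap (λ { (c , w) → scale c (f w) })

bilinExt : (Word → Word → Poly) → Poly → Poly → Poly
bilinExt f p q = concatMap (λ { (c , u) → concatMap (λ { (d , v) → scale (c * d) (f u v) }) q }) p

sh : Word → Word → Poly
sh [] v = oneW v
sh (a ∷ u) [] = oneW (a ∷ u)
sh (a ∷ u) (b ∷ v) = prefix (a ∷ []) (sh u (b ∷ v)) ++ prefix (b ∷ []) (sh (a ∷ u) v)

-- σ_m on words of 𝔥¹ (words starting with x lie outside 𝔥¹; junk value 0)
σ : ℕ → Word → Poly
σ zero [] = oneW []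
σ (suc m) [] = zeroP
σ m (y ∷ w) = prefix (y ∷ []) (sh w (replicate m x))
σ m (x ∷ w) = zeroP

-- z_k = y x^{k-1}  (used for k ≥ 1)
z : ℕ → Word
z k = y ∷ replicate (k ∸ 1) x

zs : List ℕ → Word
zs [] = []
zs (k ∷ ks) = z k ++ zs ks

-- decomposition of a word: (number of leading x's, indices of the z-blocks after them)
decomp : Word → ℕ × List ℕ
decomp [] = (0 , [])
decomp (x ∷ w) = (suc (proj₁ (decomp w)) , proj₂ (decomp w))
decomp (y ∷ w) = (0 , suc (proj₁ (decomp w)) ∷ proj₂ (decomp w))

-- for w ∈ 𝔥¹, w = zs (parse w)
parse : Word → List ℕ
parse w = proj₂ (decomp w)

tshZ : List ℕ → List ℕ → Poly
tshZ [] v = oneW (zs v)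
tshZ (k ∷ u) [] = oneW (zs (k ∷ u))
tshZ (k ∷ u) (l ∷ v) = prefix (z k) (tshZ u (l ∷ v)) ++ prefix (z l) (tshZ (k ∷ u) v)

tsh : Poly → Poly → Poly
tsh = bilinExt (λ u v → tshZ (parse u) (parse v))

sgn : ℕ → ℚ
sgn zero = 1ℚ
sgn (suc n) = - sgn n

sumP : List Poly → Poly
sumP = foldr _++_ []

ψ̄W : Word → Poly
ψ̄W w = sumP (map (λ i → scale (sgn (r ∸ i))
                    (tsh (oneW (zs (take i ks))) (σ 1 (zs (reverse (drop i ks))))))
                 (upTo r))
  where
  ks = parse w
  r  = length ks

ψ̄ : Poly → Poly
ψ̄ = linExt ψ̄W

StartsY : Word → Set
StartsY w = ∃ λ w' → w ≡ y ∷ w'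

InYH : Poly → Set
InYH p = ∀ w → ¬ (coeff w p ≡ 0ℚ) → StartsY w

InYHtshYH : Poly → Set
InYHtshYH p = ∃ λ (ts : List (ℚ × Poly × Poly)) →
  All (λ { (c , u , v) → InYH u × InYH v }) ts ×
  p ≈P sumP (map (λ { (c , u , v) → scale c (tsh u v) }) ts)

-- Write the words of y𝔥 as words in the letters z_k and let R be the span of the shuffles u ⧢~ v
-- of non-empty words. The summands of ψ̄ with i ≥ 1 lie in R, so ψ̄ p ≡ σ₁ (S p) modulo R, where
-- S is the antipode w ↦ (-1)^|w| reverse w. On z-words σ₁ is the derivation D sending each letter
-- z_k to k z_{k+1}; with the derivation E sending z_{k+1} to z_k (and z_1 to 0) it satisfies
-- [E, D] = N, where N multiplies a word by its length. Derivations preserve R, E is nilpotent and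
-- N is invertible on non-empty words, so D q ∈ R implies, by downward induction on i, that
-- Eⁱ q ∈ R for all i; in particular q ∈ R. Taking q = S p, and since S is an involution that
-- preserves R, every p in the kernel of ψ̄ lies in R.
module Submission where

open import Algebra.Bundles using (CommutativeMonoid)
open import Data.Empty using (⊥-elim)
open import Data.List using (List; []; _∷_; _++_; _∷ʳ_; map; concat; length; reverse; replicate; take; drop; upTo; applyUpTo)
import Data.List.Properties as List
open import Data.List.Relation.Unary.All as All using (All; []; _∷_)
open import Data.List.Relation.Unary.All.Properties as All using ()
open import Data.Nat as ℕ using (ℕ; zero; suc; _∸_)
open import Data.Nat.GeneralisedArithmetic using (fold; iterate; iterate-is-fold)
open import Data.Nat.ListAction using (sum)
import Data.Nat.Properties as ℕ
open import Data.Product using (_×_; _,_; proj₁; proj₂; Σ-syntax)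
open import Data.Rational using (ℚ; 0ℚ; 1ℚ; _+_; _*_; -_; _≤_; 1/_)
import Data.Rational as ℚ
import Data.Rational.Properties as ℚ
open import Data.Rational.Solver using (module +-*-Solver)
open import Data.Sum using (_⊎_; inj₁; inj₂)
open import Relation.Binary.Bundles using (Setoid)
open import Relation.Binary.Definitions using (DecidableEquality)
open import Relation.Binary.PropositionalEquality using (_≡_; refl; sym; trans; cong; cong₂; subst; module ≡-Reasoning)
open import Relation.Nullary using (yes; no; ¬_)
open +-*-Solver using (solve; _:=_; _:+_; _:*_; :-_; con)

open import Defs

-- Formal ℚ-linear combinations

Comb : Set → Set
Comb A = List (ℚ × A)

infixr 7 _·_
_·_ : ∀ {A} → ℚ → Comb A → Comb A
c · p = map (λ { (d , v) → (c * d , v) }) p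

basis : ∀ {A} → A → Comb A
basis v = (1ℚ , v) ∷ []

linear : ∀ {A B} → (A → Comb B) → Comb A → Comb B
linear f [] = []
linear f ((c , v) ∷ p) = c · f v ++ linear f p

relabel : ∀ {A B} → (A → B) → Comb A → Comb B
relabel f = map (λ { (c , v) → (c , f v) })

weightedSum : ∀ {A} → (A → ℚ) → Comb A → ℚ
weightedSum g [] = 0ℚ
weightedSum g ((c , v) ∷ p) = c * g v + weightedSum g p

module _ {A B : Set} where

  linear-++ : ∀ (f : A → Comb B) p q → linear f (p ++ q) ≡ linear f p ++ linear f q
  linear-++ f [] q = refl
  linear-++ f ((c , v) ∷ p) q =
    trans (cong (c · f v ++_) (linear-++ f p q)) (sym (List.++-assoc (c · f v) _ _))

  relabel-++ : ∀ (f : A → B) p q → relabel f (p ++ q) ≡ relabel f p ++ relabel f q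
  relabel-++ f p q = List.map-++ _ p q

  relabel-· : ∀ (f : A → B) c p → relabel f (c · p) ≡ c · relabel f p
  relabel-· f c [] = refl
  relabel-· f c ((d , v) ∷ p) = cong (_ ∷_) (relabel-· f c p)

  relabel-cong : ∀ {f g : A → B} → (∀ v → f v ≡ g v) → ∀ p → relabel f p ≡ relabel g p
  relabel-cong f≡g [] = refl
  relabel-cong f≡g ((c , v) ∷ p) = cong₂ (λ w q → (c , w) ∷ q) (f≡g v) (relabel-cong f≡g p)

module _ {A B C : Set} where

  relabel-∘ : ∀ (f : B → C) (g : A → B) p → relabel f (relabel g p) ≡ relabel (λ v → f (g v)) p
  relabel-∘ f g [] = refl
  relabel-∘ f g ((c , v) ∷ p) = cong (_ ∷_) (relabel-∘ f g p)

  linear-relabel : ∀ (f : B → Comb C) (g : A → B) p → linear f (relabel g p) ≡ linear (λ v → f (g v)) p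
  linear-relabel f g [] = refl
  linear-relabel f g ((c , v) ∷ p) = cong (c · f (g v) ++_) (linear-relabel f g p)

  relabel-linear : ∀ (g : B → C) (f : A → Comb B) p → relabel g (linear f p) ≡ linear (λ v → relabel g (f v)) p
  relabel-linear g f [] = refl
  relabel-linear g f ((c , v) ∷ p) =
    trans (relabel-++ g (c · f v) (linear f p)) (cong₂ _++_ (relabel-· g c (f v)) (relabel-linear g f p))

module _ {A : Set} where

  ·-++ : ∀ c (p q : Comb A) → c · (p ++ q) ≡ c · p ++ c · q
  ·-++ c p q = List.map-++ _ p q

  weightedSum-++ : ∀ g (p q : Comb A) → weightedSum g (p ++ q) ≡ weightedSum g p + weightedSum g q
  weightedSum-++ g [] q = sym (ℚ.+-identityˡ _)
  weightedSum-++ g ((c , v) ∷ p) q =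
    trans (cong (c * g v +_) (weightedSum-++ g p q)) (sym (ℚ.+-assoc (c * g v) _ _))

  weightedSum-· : ∀ g c (p : Comb A) → weightedSum g (c · p) ≡ c * weightedSum g p
  weightedSum-· g c [] = sym (ℚ.*-zeroʳ c)
  weightedSum-· g c ((d , v) ∷ p) = trans (cong (c * d * g v +_) (weightedSum-· g c p))
    (solve 4 (λ a b e f → a :* b :* e :+ a :* f := a :* (b :* e :+ f)) refl c d (g v) (weightedSum g p))

All-relabel : ∀ {A B} {P : ℚ × A → Set} {Q : ℚ × B → Set} (f : A → B) {X} →
              All P X → (∀ c v → P (c , v) → Q (c , f v)) → All Q (relabel f X)
All-relabel f [] P⇒Q = []
All-relabel f (Pe ∷ PX) P⇒Q = P⇒Q _ _ Pe ∷ All-relabel f PX P⇒Q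

All-· : ∀ {A} {P Q : ℚ × A → Set} c {X} → All P X → (∀ d v → P (d , v) → Q (c * d , v)) → All Q (c · X)
All-· c [] P⇒Q = []
All-· c (Pe ∷ PX) P⇒Q = P⇒Q _ _ Pe ∷ All-· c PX P⇒Q

module FormalSum {A : Set} (_≟_ : DecidableEquality A) where

  coef : A → Comb A → ℚ
  coef w [] = 0ℚ
  coef w ((c , v) ∷ p) with v ≟ w
  ... | yes _ = c + coef w p
  ... | no _ = coef w p

  -- A record rather than a Π-type, so that p and q can be inferred from a proof of p ≈ q.
  infix 4 _≈_
  record _≈_ (p q : Comb A) : Set where
    constructor mk≈
    field
      coef-≡ : ∀ w → coef w p ≡ coef w q
  open _≈_ public

  ≈-refl : ∀ {p} → p ≈ p
  ≈-refl = mk≈ λ _ → refl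

  ≈-sym : ∀ {p q} → p ≈ q → q ≈ p
  ≈-sym e = mk≈ λ w → sym (coef-≡ e w)

  ≈-trans : ∀ {p q r} → p ≈ q → q ≈ r → p ≈ r
  ≈-trans e f = mk≈ λ w → trans (coef-≡ e w) (coef-≡ f w)

  ≡⇒≈ : ∀ {p q} → p ≡ q → p ≈ q
  ≡⇒≈ refl = ≈-refl

  setoid : Setoid _ _
  setoid = record
    { Carrier = Comb A ; _≈_ = _≈_
    ; isEquivalence = record { refl = ≈-refl ; sym = ≈-sym ; trans = ≈-trans } }

  neg : Comb A → Comb A
  neg p = - 1ℚ · p

  coef-++ : ∀ w p q → coef w (p ++ q) ≡ coef w p + coef w q
  coef-++ w [] q = sym (ℚ.+-identityˡ _)
  coef-++ w ((c , v) ∷ p) q with v ≟ w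
  ... | yes _ = trans (cong (c +_) (coef-++ w p q)) (sym (ℚ.+-assoc c (coef w p) (coef w q)))
  ... | no _ = coef-++ w p q

  coef-· : ∀ w c p → coef w (c · p) ≡ c * coef w p
  coef-· w c [] = sym (ℚ.*-zeroʳ c)
  coef-· w c ((d , v) ∷ p) with v ≟ w
  ... | yes _ = trans (cong (c * d +_) (coef-· w c p)) (sym (ℚ.*-distribˡ-+ c d (coef w p)))
  ... | no _ = coef-· w c p

  ++-cong : ∀ {p p′ q q′} → p ≈ p′ → q ≈ q′ → p ++ q ≈ p′ ++ q′
  ++-cong {p} {p′} {q} {q′} e f = mk≈ λ w → begin
    coef w (p ++ q)            ≡⟨ coef-++ w p q ⟩
    coef w p + coef w q        ≡⟨ cong₂ _+_ (coef-≡ e w) (coef-≡ f w) ⟩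
    coef w p′ + coef w q′      ≡⟨ coef-++ w p′ q′ ⟨
    coef w (p′ ++ q′)          ∎
    where open ≡-Reasoning

  ++-comm : ∀ p q → p ++ q ≈ q ++ p
  ++-comm p q = mk≈ λ w →
    trans (coef-++ w p q) (trans (ℚ.+-comm (coef w p) (coef w q)) (sym (coef-++ w q p)))

  ++-assoc : ∀ p q r → (p ++ q) ++ r ≈ p ++ (q ++ r)
  ++-assoc p q r = ≡⇒≈ (List.++-assoc p q r)

  ++-identityʳ : ∀ p → p ++ [] ≈ p
  ++-identityʳ p = ≡⇒≈ (List.++-identityʳ p)

  commutativeMonoid : CommutativeMonoid _ _
  commutativeMonoid = record
    { Carrier = Comb A ; _≈_ = _≈_ ; _∙_ = _++_ ; ε = []
    ; isCommutativeMonoid = record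
      { isMonoid = record
        { isSemigroup = record
          { isMagma = record
            { isEquivalence = Setoid.isEquivalence setoid
            ; ∙-cong = ++-cong }
          ; assoc = ++-assoc }
        ; identity = (λ _ → ≈-refl) , ++-identityʳ }
      ; comm = ++-comm } }

  open import Algebra.Solver.CommutativeMonoid commutativeMonoid public
    using (_⊜_; _⊕_) renaming (solve to ++-solve)

  ·-cong : ∀ c {p q} → p ≈ q → c · p ≈ c · q
  ·-cong c {p} {q} e = mk≈ λ w →
    trans (coef-· w c p) (trans (cong (c *_) (coef-≡ e w)) (sym (coef-· w c q)))

  ·-assoc : ∀ c d p → c · d · p ≈ (c * d) · p
  ·-assoc c d p = mk≈ λ w → begin
    coef w (c · d · p)       ≡⟨ coef-· w c (d · p) ⟩
    c * coef w (d · p)       ≡⟨ cong (c *_) (coef-· w d p) ⟩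
    c * (d * coef w p)       ≡⟨ ℚ.*-assoc c d (coef w p) ⟨
    c * d * coef w p         ≡⟨ coef-· w (c * d) p ⟨
    coef w ((c * d) · p)     ∎
    where open ≡-Reasoning

  ·-identityˡ : ∀ p → 1ℚ · p ≈ p
  ·-identityˡ p = mk≈ λ w → trans (coef-· w 1ℚ p) (ℚ.*-identityˡ _)

  ·-zeroˡ : ∀ p → 0ℚ · p ≈ []
  ·-zeroˡ p = mk≈ λ w → trans (coef-· w 0ℚ p) (ℚ.*-zeroˡ (coef w p))

  ·-distribʳ : ∀ c d p → (c + d) · p ≈ c · p ++ d · p
  ·-distribʳ c d p = mk≈ λ w → begin
    coef w ((c + d) · p)               ≡⟨ coef-· w (c + d) p ⟩
    (c + d) * coef w p                 ≡⟨ ℚ.*-distribʳ-+ (coef w p) c d ⟩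
    c * coef w p + d * coef w p        ≡⟨ cong₂ _+_ (coef-· w c p) (coef-· w d p) ⟨
    coef w (c · p) + coef w (d · p)    ≡⟨ coef-++ w (c · p) (d · p) ⟨
    coef w (c · p ++ d · p)            ∎
    where open ≡-Reasoning

  ·-comm : ∀ c d p → c · d · p ≈ d · c · p
  ·-comm c d p = ≈-trans (·-assoc c d p)
    (≈-trans (≡⇒≈ (cong (_· p) (ℚ.*-comm c d))) (≈-sym (·-assoc d c p)))

  single≈·basis : ∀ c v → (c , v) ∷ [] ≈ c · basis v
  single≈·basis c v = ≡⇒≈ (cong (λ t → (t , v) ∷ []) (sym (ℚ.*-identityʳ c)))

  ++-neg : ∀ p → p ++ neg p ≈ []
  ++-neg p = mk≈ λ w →
    trans (coef-++ w p (neg p)) (trans (cong (coef w p +_) (coef-· w (- 1ℚ) p))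
      (solve 1 (λ a → a :+ (:- con 1ℚ) :* a := con 0ℚ) refl (coef w p)))

  coef-∷-≡ : ∀ {v w} c p → v ≡ w → coef w ((c , v) ∷ p) ≡ c + coef w p
  coef-∷-≡ {v} {w} c p v≡w with v ≟ w
  ... | yes _ = refl
  ... | no v≢w = ⊥-elim (v≢w v≡w)

  coef-∷-≢ : ∀ {v w} c p → ¬ v ≡ w → coef w ((c , v) ∷ p) ≡ coef w p
  coef-∷-≢ {v} {w} c p v≢w with v ≟ w
  ... | yes v≡w = ⊥-elim (v≢w v≡w)
  ... | no _ = refl

  zero-term : ∀ v p → (0ℚ , v) ∷ p ≈ p
  zero-term v p = mk≈ λ w → case w
    where
    case : ∀ w → coef w ((0ℚ , v) ∷ p) ≡ coef w p
    case w with v ≟ w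
    ... | yes _ = ℚ.+-identityˡ _
    ... | no _ = refl

  merge-terms : ∀ a b v p → (a , v) ∷ (b , v) ∷ p ≈ (a + b , v) ∷ p
  merge-terms a b v p = mk≈ λ w → case w
    where
    case : ∀ w → coef w ((a , v) ∷ (b , v) ∷ p) ≡ coef w ((a + b , v) ∷ p)
    case w with v ≟ w
    ... | yes v≡w = trans (cong (a +_) (coef-∷-≡ b p v≡w)) (sym (ℚ.+-assoc a b _))
    ... | no v≢w = coef-∷-≢ b p v≢w

  remove : A → Comb A → Comb A
  remove v [] = []
  remove v ((c , u) ∷ p) with u ≟ v
  ... | yes _ = remove v p
  ... | no _ = (c , u) ∷ remove v p

  length-remove : ∀ v p → length (remove v p) ℕ.≤ length p
  length-remove v [] = ℕ.z≤n
  length-remove v ((c , u) ∷ p) with u ≟ v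
  ... | yes _ = ℕ.m≤n⇒m≤1+n (length-remove v p)
  ... | no _ = ℕ.s≤s (length-remove v p)

  coef-remove : ∀ v p → coef v (remove v p) ≡ 0ℚ
  coef-remove v [] = refl
  coef-remove v ((c , u) ∷ p) with u ≟ v
  ... | yes _ = coef-remove v p
  ... | no u≢v with u ≟ v
  ...   | yes u≡v = ⊥-elim (u≢v u≡v)
  ...   | no _ = coef-remove v p

  coef-remove-≢ : ∀ {v w} p → ¬ v ≡ w → coef w (remove v p) ≡ coef w p
  coef-remove-≢ [] v≢w = refl
  coef-remove-≢ {v} {w} ((c , u) ∷ p) v≢w with u ≟ v
  ... | yes refl with u ≟ w
  ...   | yes u≡w = ⊥-elim (v≢w u≡w)
  ...   | no _ = coef-remove-≢ p v≢w
  coef-remove-≢ {v} {w} ((c , u) ∷ p) v≢w | no _ with u ≟ w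
  ...   | yes _ = cong (c +_) (coef-remove-≢ p v≢w)
  ...   | no _ = coef-remove-≢ p v≢w

  weightedSum-remove : ∀ g v p → weightedSum g p ≡ coef v p * g v + weightedSum g (remove v p)
  weightedSum-remove g v [] = sym (trans (ℚ.+-identityʳ _) (ℚ.*-zeroˡ (g v)))
  weightedSum-remove g v ((c , u) ∷ p) with u ≟ v
  ... | yes refl = trans (cong (c * g u +_) (weightedSum-remove g u p))
    (solve 4 (λ a b e f → a :* b :+ (e :* b :+ f) := (a :+ e) :* b :+ f) refl c (g u) (coef u p) (weightedSum g (remove u p)))
  ... | no _ = trans (cong (c * g u +_) (weightedSum-remove g v p))
    (solve 4 (λ a b e f → a :+ (e :* b :+ f) := e :* b :+ (a :+ f)) refl (c * g u) (g v) (coef v p) (weightedSum g (remove v p)))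

  -- Removing the first word of p strictly shortens it; the bound n is the fuel of this recursion.
  weightedSum-null : ∀ g n p → length p ℕ.≤ n → (∀ w → coef w p ≡ 0ℚ) → weightedSum g p ≡ 0ℚ
  weightedSum-null g n [] _ _ = refl
  weightedSum-null g (suc n) p@((c , v) ∷ q) (ℕ.s≤s |q|≤n) p≈0 = begin
    weightedSum g p                                     ≡⟨ weightedSum-remove g v p ⟩
    coef v p * g v + weightedSum g (remove v p)         ≡⟨ cong₂ _+_ (trans (cong (_* g v) (p≈0 v)) (ℚ.*-zeroˡ (g v))) rest≡0 ⟩
    0ℚ + 0ℚ                                             ≡⟨ ℚ.+-identityˡ 0ℚ ⟩
    0ℚ                                                  ∎
    where
    open ≡-Reasoning
    remove-null : ∀ w → coef w (remove v p) ≡ 0ℚ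
    remove-null w with v ≟ w
    ... | yes refl = coef-remove v p
    ... | no v≢w = trans (coef-remove-≢ p v≢w) (p≈0 w)
    remove-head : remove v p ≡ remove v q
    remove-head with v ≟ v
    ... | yes _ = refl
    ... | no v≢v = ⊥-elim (v≢v refl)
    rest≡0 : weightedSum g (remove v p) ≡ 0ℚ
    rest≡0 = weightedSum-null g n (remove v p)
      (subst (λ r → length r ℕ.≤ n) (sym remove-head) (ℕ.≤-trans (length-remove v q) |q|≤n)) remove-null

  weightedSum-cong : ∀ g {p q} → p ≈ q → weightedSum g p ≡ weightedSum g q
  weightedSum-cong g {p} {q} p≈q = begin
    weightedSum g p                                         ≡⟨ solve 2 (λ a b → a := (a :+ (:- con 1ℚ) :* b) :+ b) refl _ _ ⟩
    (weightedSum g p + - 1ℚ * weightedSum g q) + weightedSum g q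
      ≡⟨ cong (_+ weightedSum g q) difference≡0 ⟩
    0ℚ + weightedSum g q                                    ≡⟨ ℚ.+-identityˡ _ ⟩
    weightedSum g q                                         ∎
    where
    open ≡-Reasoning
    difference : Comb A
    difference = p ++ neg q
    difference-null : ∀ w → coef w difference ≡ 0ℚ
    difference-null w = trans (coef-≡ (++-cong p≈q ≈-refl) w) (coef-≡ (++-neg q) w)
    difference≡0 : weightedSum g p + - 1ℚ * weightedSum g q ≡ 0ℚ
    difference≡0 = trans (cong (weightedSum g p +_) (sym (weightedSum-· g (- 1ℚ) q)))
      (trans (sym (weightedSum-++ g p (neg q)))
        (weightedSum-null g _ difference ℕ.≤-refl difference-null))

  module _ {X : Set} where

    coef-linear : ∀ (f : X → Comb A) w p → coef w (linear f p) ≡ weightedSum (λ v → coef w (f v)) p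
    coef-linear f w [] = refl
    coef-linear f w ((c , v) ∷ p) =
      trans (coef-++ w (c · f v) (linear f p)) (cong₂ _+_ (coef-· w c (f v)) (coef-linear f w p))

    linear-cong : ∀ {f g : X → Comb A} → (∀ v → f v ≈ g v) → ∀ p → linear f p ≈ linear g p
    linear-cong f≈g [] = ≈-refl
    linear-cong f≈g ((c , v) ∷ p) = ++-cong (·-cong c (f≈g v)) (linear-cong f≈g p)

    linear-cong-on : ∀ {P : X → Set} {f g : X → Comb A} p → All (λ e → P (proj₂ e)) p →
                     (∀ v → P v → f v ≈ g v) → linear f p ≈ linear g p
    linear-cong-on [] [] f≈g = ≈-refl
    linear-cong-on ((c , v) ∷ p) (Pv ∷ Pp) f≈g = ++-cong (·-cong c (f≈g v Pv)) (linear-cong-on p Pp f≈g)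

    linear-· : ∀ (f : X → Comb A) c p → linear f (c · p) ≈ c · linear f p
    linear-· f c [] = ≈-refl
    linear-· f c ((d , v) ∷ p) =
      ≈-trans (++-cong (≈-sym (·-assoc c d (f v))) (linear-· f c p)) (≡⇒≈ (sym (·-++ c (d · f v) (linear f p))))

    linear-basis : ∀ (f : X → Comb A) v → linear f (basis v) ≈ f v
    linear-basis f v = ≈-trans (++-identityʳ _) (·-identityˡ (f v))

    linear-·-basis : ∀ (f : X → Comb A) c v → linear f (c · basis v) ≈ c · f v
    linear-·-basis f c v = ≈-trans (linear-· f c (basis v)) (·-cong c (linear-basis f v))

    linear-++ᶠ : ∀ (f g : X → Comb A) p → linear (λ v → f v ++ g v) p ≈ linear f p ++ linear g p
    linear-++ᶠ f g [] = ≈-refl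
    linear-++ᶠ f g ((c , v) ∷ p) = ≈-trans (++-cong (≡⇒≈ (·-++ c (f v) (g v))) (linear-++ᶠ f g p))
      (++-solve 4 (λ a b d e → (a ⊕ b) ⊕ (d ⊕ e) ⊜ (a ⊕ d) ⊕ (b ⊕ e)) ≈-refl (c · f v) (c · g v) (linear f p) (linear g p))

    linear-·ᶠ : ∀ c (f : X → Comb A) p → linear (λ v → c · f v) p ≈ c · linear f p
    linear-·ᶠ c f [] = ≈-refl
    linear-·ᶠ c f ((d , v) ∷ p) =
      ≈-trans (++-cong (·-comm d c (f v)) (linear-·ᶠ c f p)) (≡⇒≈ (sym (·-++ c (d · f v) (linear f p))))

    linear-basis-relabel : ∀ (g : X → A) p → linear (λ v → basis (g v)) p ≈ relabel g p
    linear-basis-relabel g [] = ≈-refl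
    linear-basis-relabel g ((c , v) ∷ p) =
      ++-cong (≡⇒≈ (cong (λ t → (t , g v) ∷ []) (ℚ.*-identityʳ c))) (linear-basis-relabel g p)

    linear-∘ : ∀ {Y : Set} (f : Y → Comb X) (g : X → Comb A) p → linear g (linear f p) ≈ linear (λ v → linear g (f v)) p
    linear-∘ f g [] = ≈-refl
    linear-∘ f g ((c , v) ∷ p) =
      ≈-trans (≡⇒≈ (linear-++ g (c · f v) (linear f p))) (++-cong (linear-· g c (f v)) (linear-∘ f g p))

  linear-basis-id : ∀ p → linear basis p ≈ p
  linear-basis-id p = ≈-trans (linear-basis-relabel (λ v → v) p) (≡⇒≈ (List.map-id p))

module LinearMap {A B : Set} (_≟A_ : DecidableEquality A) (_≟B_ : DecidableEquality B) where
  private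
    module A = FormalSum _≟A_
    module B = FormalSum _≟B_

  linear-resp : ∀ (f : A → Comb B) {p q} → p A.≈ q → linear f p B.≈ linear f q
  linear-resp f {p} {q} p≈q = B.mk≈ λ w →
    trans (B.coef-linear f w p) (trans (A.weightedSum-cong _ p≈q) (sym (B.coef-linear f w q)))

  relabel-resp : ∀ (f : A → B) {p q} → p A.≈ q → relabel f p B.≈ relabel f q
  relabel-resp f {p} {q} p≈q = B.≈-trans (B.≈-sym (B.linear-basis-relabel f p))
    (B.≈-trans (linear-resp (λ v → basis (f v)) p≈q) (B.linear-basis-relabel f q))

  coef-relabel : ∀ (f : A → B) → (∀ {a b} → f a ≡ f b → a ≡ b) → ∀ a p → B.coef (f a) (relabel f p) ≡ A.coef a p
  coef-relabel f f-inj a [] = refl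
  coef-relabel f f-inj a ((c , v) ∷ p) with v ≟A a | f v ≟B f a
  ... | yes _ | yes _ = cong (c +_) (coef-relabel f f-inj a p)
  ... | yes v≡a | no fv≢fa = ⊥-elim (fv≢fa (cong f v≡a))
  ... | no v≢a | yes fv≡fa = ⊥-elim (v≢a (f-inj fv≡fa))
  ... | no _ | no _ = coef-relabel f f-inj a p

  relabel-reflects : ∀ (f : A → B) → (∀ {a b} → f a ≡ f b → a ≡ b) → ∀ {p q} → relabel f p B.≈ relabel f q → p A.≈ q
  relabel-reflects f f-inj {p} {q} e = A.mk≈ λ a →
    trans (sym (coef-relabel f f-inj a p)) (trans (B.coef-≡ e (f a)) (coef-relabel f f-inj a q))

-- Shuffles and derivations on index words

module IndexWords where

  -- Words in the letters z_k, written as their index lists: the index k stands for z_{k+1}.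
  IWord : Set
  IWord = List ℕ

  _≟ᵢ_ : DecidableEquality IWord
  _≟ᵢ_ = List.≡-dec ℕ._≟_

  open FormalSum _≟ᵢ_ public
  open LinearMap _≟ᵢ_ _≟ᵢ_ public using (linear-resp; relabel-resp)
  open import Relation.Binary.Reasoning.Setoid setoid

  prepend : ℕ → Comb IWord → Comb IWord
  prepend k = relabel (k ∷_)

  prepend-resp : ∀ k {X Y} → X ≈ Y → prepend k X ≈ prepend k Y
  prepend-resp k = relabel-resp (k ∷_)

  infix 6 _⧢_ _⧢ₗ_ _⧢ᵣ_
  _⧢_ : IWord → IWord → Comb IWord
  [] ⧢ b = basis b
  (k ∷ a) ⧢ [] = basis (k ∷ a)
  (k ∷ a) ⧢ (l ∷ b) = prepend k (a ⧢ (l ∷ b)) ++ prepend l ((k ∷ a) ⧢ b)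

  ⧢-identityʳ : ∀ a → a ⧢ [] ≡ basis a
  ⧢-identityʳ [] = refl
  ⧢-identityʳ (k ∷ a) = refl

  _⧢ₗ_ : Comb IWord → IWord → Comb IWord
  X ⧢ₗ b = linear (_⧢ b) X

  _⧢ᵣ_ : IWord → Comb IWord → Comb IWord
  a ⧢ᵣ X = linear (a ⧢_) X

  ∂ : (ℕ → ℚ) → (ℕ → ℕ) → IWord → Comb IWord
  ∂ c j [] = []
  ∂ c j (k ∷ w) = (c k , j k ∷ w) ∷ prepend k (∂ c j w)

  ∂ₗ : (ℕ → ℚ) → (ℕ → ℕ) → Comb IWord → Comb IWord
  ∂ₗ c j = linear (∂ c j)

  ∂ₗ-prepend : ∀ c j k X → ∂ₗ c j (prepend k X) ≈ c k · prepend (j k) X ++ prepend k (∂ₗ c j X)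
  ∂ₗ-prepend c j k X = begin
    ∂ₗ c j (prepend k X)
      ≡⟨ linear-relabel (∂ c j) (k ∷_) X ⟩
    linear (λ v → (c k , j k ∷ v) ∷ [] ++ prepend k (∂ c j v)) X
      ≈⟨ linear-++ᶠ (λ v → (c k , j k ∷ v) ∷ []) (λ v → prepend k (∂ c j v)) X ⟩
    linear (λ v → (c k , j k ∷ v) ∷ []) X ++ linear (λ v → prepend k (∂ c j v)) X
      ≈⟨ ++-cong (linear-cong (λ v → single≈·basis (c k) (j k ∷ v)) X) (≡⇒≈ (sym (relabel-linear (k ∷_) (∂ c j) X))) ⟩
    linear (λ v → c k · basis (j k ∷ v)) X ++ prepend k (∂ₗ c j X)
      ≈⟨ ++-cong (≈-trans (linear-·ᶠ (c k) (λ v → basis (j k ∷ v)) X) (·-cong (c k) (linear-basis-relabel (j k ∷_) X))) ≈-refl ⟩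
    c k · prepend (j k) X ++ prepend k (∂ₗ c j X)
      ∎

  ⧢ₗ-prepend : ∀ k l b Y → prepend k Y ⧢ₗ (l ∷ b) ≈ prepend k (Y ⧢ₗ (l ∷ b)) ++ prepend l (prepend k Y ⧢ₗ b)
  ⧢ₗ-prepend k l b Y = begin
    prepend k Y ⧢ₗ (l ∷ b)
      ≡⟨ linear-relabel (_⧢ (l ∷ b)) (k ∷_) Y ⟩
    linear (λ a → prepend k (a ⧢ (l ∷ b)) ++ prepend l ((k ∷ a) ⧢ b)) Y
      ≈⟨ linear-++ᶠ (λ a → prepend k (a ⧢ (l ∷ b))) (λ a → prepend l ((k ∷ a) ⧢ b)) Y ⟩
    linear (λ a → prepend k (a ⧢ (l ∷ b))) Y ++ linear (λ a → prepend l ((k ∷ a) ⧢ b)) Y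
      ≡⟨ cong₂ _++_ (sym (relabel-linear (k ∷_) (_⧢ (l ∷ b)) Y))
                    (trans (sym (relabel-linear (l ∷_) (λ a → (k ∷ a) ⧢ b) Y)) (cong (prepend l) (sym (linear-relabel (_⧢ b) (k ∷_) Y)))) ⟩
    prepend k (Y ⧢ₗ (l ∷ b)) ++ prepend l (prepend k Y ⧢ₗ b)
      ∎

  ⧢ᵣ-prepend : ∀ k a l Y → (k ∷ a) ⧢ᵣ prepend l Y ≈ prepend k (a ⧢ᵣ prepend l Y) ++ prepend l ((k ∷ a) ⧢ᵣ Y)
  ⧢ᵣ-prepend k a l Y = begin
    (k ∷ a) ⧢ᵣ prepend l Y
      ≡⟨ linear-relabel ((k ∷ a) ⧢_) (l ∷_) Y ⟩
    linear (λ b → prepend k (a ⧢ (l ∷ b)) ++ prepend l ((k ∷ a) ⧢ b)) Y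
      ≈⟨ linear-++ᶠ (λ b → prepend k (a ⧢ (l ∷ b))) (λ b → prepend l ((k ∷ a) ⧢ b)) Y ⟩
    linear (λ b → prepend k (a ⧢ (l ∷ b))) Y ++ linear (λ b → prepend l ((k ∷ a) ⧢ b)) Y
      ≡⟨ cong₂ _++_ (trans (sym (relabel-linear (k ∷_) (λ b → a ⧢ (l ∷ b)) Y)) (cong (prepend k) (sym (linear-relabel (a ⧢_) (l ∷_) Y))))
                    (sym (relabel-linear (l ∷_) ((k ∷ a) ⧢_) Y)) ⟩
    prepend k (a ⧢ᵣ prepend l Y) ++ prepend l ((k ∷ a) ⧢ᵣ Y)
      ∎

  ∂-⧢ : ∀ c j a b → ∂ₗ c j (a ⧢ b) ≈ ∂ c j a ⧢ₗ b ++ a ⧢ᵣ ∂ c j b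
  ∂-⧢ c j [] b = ≈-trans (linear-basis (∂ c j) b) (≈-sym (linear-basis-id (∂ c j b)))
  ∂-⧢ c j (k ∷ a) [] = begin
    ∂ₗ c j (basis (k ∷ a))                 ≈⟨ linear-basis (∂ c j) (k ∷ a) ⟩
    ∂ c j (k ∷ a)                          ≈⟨ linear-basis-id (∂ c j (k ∷ a)) ⟨
    linear basis (∂ c j (k ∷ a))           ≈⟨ linear-cong (λ a′ → ≡⇒≈ (sym (⧢-identityʳ a′))) (∂ c j (k ∷ a)) ⟩
    ∂ c j (k ∷ a) ⧢ₗ []                    ≈⟨ ++-identityʳ _ ⟨
    ∂ c j (k ∷ a) ⧢ₗ [] ++ []              ∎
  ∂-⧢ c j (k ∷ a) (l ∷ b) = begin
    ∂ₗ c j (prepend k (a ⧢ (l ∷ b)) ++ prepend l ((k ∷ a) ⧢ b))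
      ≈⟨ left (∂-⧢ c j a (l ∷ b)) (∂-⧢ c j (k ∷ a) b) ⟩
    (A1 ++ A2 ++ A3 ++ A4) ++ A5 ++ (A6 ++ A7) ++ A8
      ≈⟨ ++-solve 8 (λ a1 a2 a3 a4 a5 a6 a7 a8 → (a1 ⊕ (a2 ⊕ (a3 ⊕ a4))) ⊕ (a5 ⊕ ((a6 ⊕ a7) ⊕ a8))
                                               ⊜ ((a1 ⊕ a6) ⊕ (a2 ⊕ a7)) ⊕ ((a3 ⊕ a5) ⊕ (a4 ⊕ a8))) ≈-refl A1 A2 A3 A4 A5 A6 A7 A8 ⟩
    ((A1 ++ A6) ++ A2 ++ A7) ++ (A3 ++ A5) ++ A4 ++ A8
      ≈⟨ right ⟨
    ∂ c j (k ∷ a) ⧢ₗ (l ∷ b) ++ (k ∷ a) ⧢ᵣ ∂ c j (l ∷ b)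
      ∎
    where
    D : IWord → Comb IWord
    D = ∂ c j
    A1 A2 A3 A4 A5 A6 A7 A8 : Comb IWord
    A1 = c k · prepend (j k) (a ⧢ (l ∷ b))
    A2 = prepend k (D a ⧢ₗ (l ∷ b))
    A3 = c l · prepend k (a ⧢ (j l ∷ b))
    A4 = prepend k (a ⧢ᵣ prepend l (D b))
    A5 = c l · prepend (j l) ((k ∷ a) ⧢ b)
    A6 = c k · prepend l ((j k ∷ a) ⧢ b)
    A7 = prepend l (prepend k (D a) ⧢ₗ b)
    A8 = prepend l ((k ∷ a) ⧢ᵣ D b)
    left : ∂ₗ c j (a ⧢ (l ∷ b)) ≈ D a ⧢ₗ (l ∷ b) ++ a ⧢ᵣ D (l ∷ b) →
           ∂ₗ c j ((k ∷ a) ⧢ b) ≈ D (k ∷ a) ⧢ₗ b ++ (k ∷ a) ⧢ᵣ D b →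
           ∂ₗ c j (prepend k (a ⧢ (l ∷ b)) ++ prepend l ((k ∷ a) ⧢ b)) ≈ (A1 ++ A2 ++ A3 ++ A4) ++ A5 ++ (A6 ++ A7) ++ A8
    left ih₁ ih₂ = begin
      ∂ₗ c j (prepend k (a ⧢ (l ∷ b)) ++ prepend l ((k ∷ a) ⧢ b))
        ≡⟨ linear-++ D (prepend k (a ⧢ (l ∷ b))) (prepend l ((k ∷ a) ⧢ b)) ⟩
      ∂ₗ c j (prepend k (a ⧢ (l ∷ b))) ++ ∂ₗ c j (prepend l ((k ∷ a) ⧢ b))
        ≈⟨ ++-cong (∂ₗ-prepend c j k (a ⧢ (l ∷ b))) (∂ₗ-prepend c j l ((k ∷ a) ⧢ b)) ⟩
      (A1 ++ prepend k (∂ₗ c j (a ⧢ (l ∷ b)))) ++ A5 ++ prepend l (∂ₗ c j ((k ∷ a) ⧢ b))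
        ≈⟨ ++-cong (++-cong (≈-refl {A1}) (prepend-resp k ih₁)) (++-cong (≈-refl {A5}) (prepend-resp l ih₂)) ⟩
      (A1 ++ prepend k (D a ⧢ₗ (l ∷ b) ++ c l · (a ⧢ (j l ∷ b)) ++ a ⧢ᵣ prepend l (D b)))
        ++ A5 ++ prepend l ((c k · ((j k ∷ a) ⧢ b) ++ prepend k (D a) ⧢ₗ b) ++ A8′)
        ≡⟨ cong₂ (λ u v → (A1 ++ u) ++ A5 ++ v)
             (trans (relabel-++ (k ∷_) (D a ⧢ₗ (l ∷ b)) _)
               (cong (A2 ++_) (trans (relabel-++ (k ∷_) (c l · (a ⧢ (j l ∷ b))) _) (cong (_++ A4) (relabel-· (k ∷_) (c l) _)))))
             (trans (relabel-++ (l ∷_) (c k · ((j k ∷ a) ⧢ b) ++ prepend k (D a) ⧢ₗ b) _)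
               (cong (_++ A8) (trans (relabel-++ (l ∷_) (c k · ((j k ∷ a) ⧢ b)) _) (cong (_++ A7) (relabel-· (l ∷_) (c k) _))))) ⟩
      (A1 ++ A2 ++ A3 ++ A4) ++ A5 ++ (A6 ++ A7) ++ A8
        ∎
      where
      A8′ : Comb IWord
      A8′ = (k ∷ a) ⧢ᵣ D b
    right : ∂ c j (k ∷ a) ⧢ₗ (l ∷ b) ++ (k ∷ a) ⧢ᵣ ∂ c j (l ∷ b) ≈ ((A1 ++ A6) ++ A2 ++ A7) ++ (A3 ++ A5) ++ A4 ++ A8
    right = ++-cong (++-cong (≡⇒≈ (·-++ (c k) (prepend (j k) (a ⧢ (l ∷ b))) _)) (⧢ₗ-prepend k l b (D a)))
                    (++-cong (≡⇒≈ (·-++ (c l) (prepend k (a ⧢ (j l ∷ b))) _)) (⧢ᵣ-prepend k a l (D b)))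

  -- Decomposables

  AllWords : (IWord → Set) → Comb IWord → Set
  AllWords P X = All (λ e → P (proj₂ e)) X

  AllWords-· : ∀ {P} c X → AllWords P X → AllWords P (c · X)
  AllWords-· c X = All.map⁺ 

  AllWords-relabel : ∀ {P} f X → AllWords (λ w → P (f w)) X → AllWords P (relabel f X)
  AllWords-relabel f X = All.map⁺

  AllWords-linear : ∀ {P Q : IWord → Set} f X → AllWords P X → (∀ v → P v → AllWords Q (f v)) → AllWords Q (linear f X)
  AllWords-linear f [] [] _ = []
  AllWords-linear f ((c , v) ∷ X) (Pv ∷ PX) P⇒Q = All.++⁺ (AllWords-· c (f v) (P⇒Q v Pv)) (AllWords-linear f X PX P⇒Q)

  Homogeneous : ℕ → Comb IWord → Set
  Homogeneous n = AllWords (λ w → length w ≡ n)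

  ∂-homogeneous : ∀ c j w → Homogeneous (length w) (∂ c j w)
  ∂-homogeneous c j [] = []
  ∂-homogeneous c j (k ∷ w) = refl ∷ AllWords-relabel (k ∷_) (∂ c j w) (All.map (cong suc) (∂-homogeneous c j w))

  ⧢-homogeneous : ∀ a b → Homogeneous (length a ℕ.+ length b) (a ⧢ b)
  ⧢-homogeneous [] b = refl ∷ []
  ⧢-homogeneous (k ∷ a) [] = cong suc (sym (ℕ.+-identityʳ (length a))) ∷ []
  ⧢-homogeneous (k ∷ a) (l ∷ b) = All.++⁺
    (AllWords-relabel (k ∷_) (a ⧢ (l ∷ b)) (All.map (cong suc) (⧢-homogeneous a (l ∷ b))))
    (AllWords-relabel (l ∷_) ((k ∷ a) ⧢ b)
      (All.map (λ e → trans (cong suc e) (sym (ℕ.+-suc (suc (length a)) (length b)))) (⧢-homogeneous (k ∷ a) b)))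

  data NonEmpty : IWord → Set where
    nonEmpty : ∀ {k a} → NonEmpty (k ∷ a)

  length≡suc⇒NonEmpty : ∀ {n} w → length w ≡ suc n → NonEmpty w
  length≡suc⇒NonEmpty (k ∷ w) _ = nonEmpty

  ∂-nonEmpty : ∀ c j w → NonEmpty w → AllWords NonEmpty (∂ c j w)
  ∂-nonEmpty c j w@(_ ∷ _) nonEmpty = All.map (length≡suc⇒NonEmpty _) (∂-homogeneous c j w)

  ShuffleTerm : Set
  ShuffleTerm = ℚ × IWord × IWord

  shuffleSum : List ShuffleTerm → Comb IWord
  shuffleSum [] = []
  shuffleSum ((c , a , b) ∷ ts) = c · (a ⧢ b) ++ shuffleSum ts

  NonEmptyFactors : ShuffleTerm → Set
  NonEmptyFactors (_ , a , b) = NonEmpty a × NonEmpty b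

  -- The span y𝔥 ⧢~ y𝔥 in index coordinates: non-empty index words are the z-words of y𝔥.
  Decomposable : Comb IWord → Set
  Decomposable X = Σ[ ts ∈ List ShuffleTerm ] All NonEmptyFactors ts × X ≈ shuffleSum ts

  Decomposable-resp : ∀ {X Y} → X ≈ Y → Decomposable Y → Decomposable X
  Decomposable-resp X≈Y (ts , nts , Y≈) = ts , nts , ≈-trans X≈Y Y≈

  Decomposable-[] : Decomposable []
  Decomposable-[] = [] , [] , ≈-refl

  Decomposable-⧢ : ∀ {a b} → NonEmpty a → NonEmpty b → Decomposable (a ⧢ b)
  Decomposable-⧢ {a} {b} na nb = (1ℚ , a , b) ∷ [] , (na , nb) ∷ [] , ≈-sym (≈-trans (++-identityʳ _) (·-identityˡ _))

  Decomposable-++ : ∀ {X Y} → Decomposable X → Decomposable Y → Decomposable (X ++ Y)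
  Decomposable-++ (ts , nts , X≈) (us , nus , Y≈) =
    ts ++ us , All.++⁺ nts nus , ≈-trans (++-cong X≈ Y≈) (≈-sym (shuffleSum-++ ts us))
    where
    shuffleSum-++ : ∀ ts us → shuffleSum (ts ++ us) ≈ shuffleSum ts ++ shuffleSum us
    shuffleSum-++ [] us = ≈-refl
    shuffleSum-++ ((c , a , b) ∷ ts) us =
      ≈-trans (++-cong (≈-refl {c · (a ⧢ b)}) (shuffleSum-++ ts us)) (≈-sym (++-assoc (c · (a ⧢ b)) _ _))

  Decomposable-· : ∀ c {X} → Decomposable X → Decomposable (c · X)
  Decomposable-· c (ts , nts , X≈) = map scaleTerm ts , All.map⁺ nts , ≈-trans (·-cong c X≈) (≈-sym (shuffleSum-· ts))
    where
    scaleTerm : ShuffleTerm → ShuffleTerm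
    scaleTerm (d , a , b) = (c * d , a , b)
    shuffleSum-· : ∀ ts → shuffleSum (map scaleTerm ts) ≈ c · shuffleSum ts
    shuffleSum-· [] = ≈-refl
    shuffleSum-· ((d , a , b) ∷ ts) = ≈-trans (++-cong (≈-sym (·-assoc c d (a ⧢ b))) (shuffleSum-· ts))
      (≡⇒≈ (sym (·-++ c (d · (a ⧢ b)) (shuffleSum ts))))

  Decomposable-cancelˡ : ∀ X Y → Decomposable (X ++ Y) → Decomposable X → Decomposable Y
  Decomposable-cancelˡ X Y dXY dX = Decomposable-resp Y≈ (Decomposable-++ dXY (Decomposable-· (- 1ℚ) dX))
    where
    Y≈ : Y ≈ (X ++ Y) ++ neg X
    Y≈ = ≈-sym (≈-trans (++-solve 3 (λ u v w → (u ⊕ v) ⊕ w ⊜ v ⊕ (u ⊕ w)) ≈-refl X Y (neg X))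
                        (≈-trans (++-cong (≈-refl {Y}) (++-neg X)) (++-identityʳ Y)))

  Decomposable-linear : ∀ f X → AllWords (λ v → Decomposable (f v)) X → Decomposable (linear f X)
  Decomposable-linear f [] [] = Decomposable-[]
  Decomposable-linear f ((c , v) ∷ X) (dv ∷ dX) = Decomposable-++ (Decomposable-· c dv) (Decomposable-linear f X dX)

  linear-preserves-Decomposable : ∀ F → (∀ {a b} → NonEmpty a → NonEmpty b → Decomposable (linear F (a ⧢ b))) →
                                  ∀ {X} → Decomposable X → Decomposable (linear F X)
  linear-preserves-Decomposable F F⧢ (ts , nts , X≈) =
    Decomposable-resp (linear-resp F X≈) (image ts nts)
    where
    image : ∀ ts → All NonEmptyFactors ts → Decomposable (linear F (shuffleSum ts))
    image [] [] = Decomposable-[]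
    image ((d , a , b) ∷ ts) ((na , nb) ∷ nts) =
      Decomposable-resp (≈-trans (≡⇒≈ (linear-++ F (d · (a ⧢ b)) (shuffleSum ts))) (++-cong (linear-· F d (a ⧢ b)) ≈-refl))
        (Decomposable-++ (Decomposable-· d (F⧢ na nb)) (image ts nts))

  ⧢ₗ-Decomposable : ∀ {b} Y → AllWords NonEmpty Y → NonEmpty b → Decomposable (Y ⧢ₗ b)
  ⧢ₗ-Decomposable Y nY nb = Decomposable-linear _ Y (All.map (λ nv → Decomposable-⧢ nv nb) nY)

  ⧢ᵣ-Decomposable : ∀ {a} Y → NonEmpty a → AllWords NonEmpty Y → Decomposable (a ⧢ᵣ Y)
  ⧢ᵣ-Decomposable Y na nY = Decomposable-linear _ Y (All.map (λ nv → Decomposable-⧢ na nv) nY)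

  ∂ₗ-preserves-Decomposable : ∀ c j {X} → Decomposable X → Decomposable (∂ₗ c j X)
  ∂ₗ-preserves-Decomposable c j = linear-preserves-Decomposable (∂ c j) λ {a} {b} na nb →
    Decomposable-resp (∂-⧢ c j a b)
      (Decomposable-++ (⧢ₗ-Decomposable (∂ c j a) (∂-nonEmpty c j a na) nb)
                       (⧢ᵣ-Decomposable (∂ c j b) na (∂-nonEmpty c j b nb)))

  -- The commutation relation [lower, raise] = count

  fromℕ : ℕ → ℚ
  fromℕ zero = 0ℚ
  fromℕ (suc n) = 1ℚ + fromℕ n

  fromℕ-suc≢0 : ∀ n → ¬ fromℕ (suc n) ≡ 0ℚ
  fromℕ-suc≢0 n e = ℚ.<⇒≢ (ℚ.+-mono-<-≤ (ℚ.positive⁻¹ 1ℚ) (nonNegative n)) (sym e)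
    where
    nonNegative : ∀ n → 0ℚ ≤ fromℕ n
    nonNegative zero = ℚ.≤-refl
    nonNegative (suc n) = ℚ.+-mono-≤ (ℚ.nonNegative⁻¹ 1ℚ) (nonNegative n)

  lowerCoef : ℕ → ℚ
  lowerCoef zero = 0ℚ
  lowerCoef (suc k) = 1ℚ

  -- raise is σ₁ in index coordinates: σ₁ (z_{k+1}) = y (x^k ⧢ x) = (k+1) z_{k+2}.
  raise lower count : IWord → Comb IWord
  raise = ∂ (λ k → fromℕ (suc k)) suc
  lower = ∂ lowerCoef ℕ.pred
  count = ∂ (λ _ → 1ℚ) (λ k → k)

  raiseₗ lowerₗ countₗ : Comb IWord → Comb IWord
  raiseₗ = linear raise
  lowerₗ = linear lower
  countₗ = linear count

  -- [lower, raise] on a first letter k: the first term on the right is the one of raiseₗ (lower _).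
  lower-raise-letter : ∀ k v → (fromℕ (suc k) * 1ℚ , k ∷ v) ∷ [] ≈
                       (lowerCoef k * fromℕ (suc (ℕ.pred k)) , suc (ℕ.pred k) ∷ v) ∷ (1ℚ , k ∷ v) ∷ []
  lower-raise-letter zero v = begin
    (fromℕ 1 * 1ℚ , 0 ∷ v) ∷ []                  ≡⟨ cong (λ c → (c , 0 ∷ v) ∷ []) (ℚ.+-identityʳ 1ℚ) ⟩
    (1ℚ , 0 ∷ v) ∷ []                            ≈⟨ zero-term (1 ∷ v) _ ⟨
    (0ℚ , 1 ∷ v) ∷ (1ℚ , 0 ∷ v) ∷ []             ≡⟨ cong (λ c → (c , 1 ∷ v) ∷ (1ℚ , 0 ∷ v) ∷ []) (sym (ℚ.*-zeroˡ (fromℕ 1))) ⟩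
    (0ℚ * fromℕ 1 , 1 ∷ v) ∷ (1ℚ , 0 ∷ v) ∷ []   ∎
  lower-raise-letter (suc k) v = ≈-sym (≈-trans (merge-terms _ 1ℚ (suc k ∷ v) [])
    (≡⇒≈ (cong (λ c → (c , suc k ∷ v) ∷ [])
      (solve 1 (λ q → con 1ℚ :* (con 1ℚ :+ q) :+ con 1ℚ := (con 1ℚ :+ (con 1ℚ :+ q)) :* con 1ℚ) refl (fromℕ k)))))

  lower-raise : ∀ w → lowerₗ (raise w) ≈ raiseₗ (lower w) ++ count w
  lower-raise [] = ≈-refl
  lower-raise (k ∷ v) = begin
    lowerₗ (raise (k ∷ v))
      ≈⟨ ++-cong (++-cong (lower-raise-letter k v) (≈-refl {B1}))
                 (≈-trans (∂ₗ-prepend lowerCoef ℕ.pred k (raise v)) (++-cong (≈-refl {B2}) (prepend-resp k (lower-raise v)))) ⟩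
    ((T1 ∷ T2 ∷ []) ++ B1) ++ B2 ++ prepend k (raiseₗ (lower v) ++ count v)
      ≡⟨ cong (λ p → ((T1 ∷ T2 ∷ []) ++ B1) ++ B2 ++ p) (relabel-++ (k ∷_) (raiseₗ (lower v)) (count v)) ⟩
    ((T1 ∷ T2 ∷ []) ++ B1) ++ B2 ++ B3 ++ B4
      ≈⟨ ++-solve 6 (λ t1 t2 b1 b2 b3 b4 → ((t1 ⊕ t2) ⊕ b1) ⊕ (b2 ⊕ (b3 ⊕ b4)) ⊜ ((t1 ⊕ b2) ⊕ (b1 ⊕ b3)) ⊕ (t2 ⊕ b4))
                    ≈-refl (T1 ∷ []) (T2 ∷ []) B1 B2 B3 B4 ⟩
    ((T1 ∷ B2) ++ B1 ++ B3) ++ T2 ∷ B4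
      ≈⟨ ++-cong (++-cong (≈-refl {T1 ∷ B2}) (∂ₗ-prepend (λ k → fromℕ (suc k)) suc k (lower v))) ≈-refl ⟨
    raiseₗ (lower (k ∷ v)) ++ count (k ∷ v)
      ∎
    where
    T1 T2 : ℚ × IWord
    B1 B2 B3 B4 : Comb IWord
    T1 = (lowerCoef k * fromℕ (suc (ℕ.pred k)) , suc (ℕ.pred k) ∷ v)
    T2 = (1ℚ , k ∷ v)
    B1 = fromℕ (suc k) · prepend (suc k) (lower v)
    B2 = lowerCoef k · prepend (ℕ.pred k) (raise v)
    B3 = prepend k (raiseₗ (lower v))
    B4 = prepend k (count v)

  lowerₗ-raiseₗ : ∀ X → lowerₗ (raiseₗ X) ≈ raiseₗ (lowerₗ X) ++ countₗ X
  lowerₗ-raiseₗ X = begin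
    lowerₗ (raiseₗ X)                                               ≈⟨ linear-∘ raise lower X ⟩
    linear (λ v → lowerₗ (raise v)) X                               ≈⟨ linear-cong lower-raise X ⟩
    linear (λ v → raiseₗ (lower v) ++ count v) X                    ≈⟨ linear-++ᶠ (λ v → raiseₗ (lower v)) count X ⟩
    linear (λ v → raiseₗ (lower v)) X ++ countₗ X                   ≈⟨ ++-cong (linear-∘ lower raise X) (≈-refl {countₗ X}) ⟨
    raiseₗ (lowerₗ X) ++ countₗ X                                   ∎

  count≈length· : ∀ w → count w ≈ fromℕ (length w) · basis w
  count≈length· [] = ≈-sym (·-zeroˡ (basis []))
  count≈length· (k ∷ v) = begin
    basis (k ∷ v) ++ prepend k (count v)                            ≈⟨ ++-cong ≈-refl (prepend-resp k (count≈length· v)) ⟩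
    basis (k ∷ v) ++ prepend k (fromℕ (length v) · basis v)         ≡⟨ cong (basis (k ∷ v) ++_) (relabel-· (k ∷_) (fromℕ (length v)) (basis v)) ⟩
    basis (k ∷ v) ++ fromℕ (length v) · basis (k ∷ v)               ≈⟨ ++-cong (·-identityˡ (basis (k ∷ v))) ≈-refl ⟨
    1ℚ · basis (k ∷ v) ++ fromℕ (length v) · basis (k ∷ v)          ≈⟨ ·-distribʳ 1ℚ (fromℕ (length v)) (basis (k ∷ v)) ⟨
    fromℕ (length (k ∷ v)) · basis (k ∷ v)                          ∎

  scaleByLength : (ℕ → ℚ) → Comb IWord → Comb IWord
  scaleByLength g = linear (λ w → g (length w) · basis w)

  scaleByLength-homogeneous : ∀ g n X → Homogeneous n X → scaleByLength g X ≈ g n · X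
  scaleByLength-homogeneous g n X hX = begin
    scaleByLength g X                        ≈⟨ linear-cong-on X hX (λ v |v|≡n → ≡⇒≈ (cong (λ m → g m · basis v) |v|≡n)) ⟩
    linear (λ v → g n · basis v) X           ≈⟨ linear-·ᶠ (g n) basis X ⟩
    g n · linear basis X                     ≈⟨ ·-cong (g n) (linear-basis-id X) ⟩
    g n · X                                  ∎

  countₗ-homogeneous : ∀ n X → Homogeneous n X → countₗ X ≈ fromℕ n · X
  countₗ-homogeneous n X hX = ≈-trans (linear-cong count≈length· X) (scaleByLength-homogeneous fromℕ n X hX)

  lowerₗ-countₗ : ∀ X → lowerₗ (countₗ X) ≈ countₗ (lowerₗ X)
  lowerₗ-countₗ X = begin
    lowerₗ (countₗ X)                        ≈⟨ linear-∘ count lower X ⟩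
    linear (λ v → lowerₗ (count v)) X        ≈⟨ linear-cong lower-count X ⟩
    linear (λ v → countₗ (lower v)) X        ≈⟨ linear-∘ lower count X ⟨
    countₗ (lowerₗ X)                        ∎
    where
    lower-count : ∀ w → lowerₗ (count w) ≈ countₗ (lower w)
    lower-count w = begin
      lowerₗ (count w)                                  ≈⟨ linear-resp lower (count≈length· w) ⟩
      lowerₗ (fromℕ (length w) · basis w)               ≈⟨ linear-·-basis lower (fromℕ (length w)) w ⟩
      fromℕ (length w) · lower w                        ≈⟨ countₗ-homogeneous (length w) (lower w) (∂-homogeneous lowerCoef ℕ.pred w) ⟨
      countₗ (lower w)                                  ∎

  WeightBelow : ℕ → Comb IWord → Set
  WeightBelow n = All (λ e → proj₁ e ≡ 0ℚ ⊎ sum (proj₂ e) ℕ.< n)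

  lower-decreases-weight : ∀ w → All (λ e → proj₁ e ≡ 0ℚ ⊎ suc (sum (proj₂ e)) ≡ sum w) (lower w)
  lower-decreases-weight [] = []
  lower-decreases-weight (zero ∷ v) = inj₁ refl ∷ All-relabel (0 ∷_) (lower-decreases-weight v) (λ _ _ e → e)
  lower-decreases-weight (suc k ∷ v) = inj₂ refl ∷ All-relabel (suc k ∷_) (lower-decreases-weight v) shift
    where
    shift : ∀ d u → d ≡ 0ℚ ⊎ suc (sum u) ≡ sum v → d ≡ 0ℚ ⊎ suc (sum (suc k ∷ u)) ≡ sum (suc k ∷ v)
    shift d u (inj₁ d≡0) = inj₁ d≡0
    shift d u (inj₂ e) = inj₂ (cong suc (trans (sym (ℕ.+-suc k (sum u))) (cong (k ℕ.+_) e)))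

  WeightBelow-lowerₗ : ∀ n X → WeightBelow (suc n) X → WeightBelow n (lowerₗ X)
  WeightBelow-lowerₗ n [] [] = []
  WeightBelow-lowerₗ n ((c , w) ∷ X) (bw ∷ bX) =
    All.++⁺ (All-· c (lower-decreases-weight w) (term bw)) (WeightBelow-lowerₗ n X bX)
    where
    term : c ≡ 0ℚ ⊎ sum w ℕ.< suc n → ∀ d u → d ≡ 0ℚ ⊎ suc (sum u) ≡ sum w → c * d ≡ 0ℚ ⊎ sum u ℕ.< n
    term (inj₁ refl) d u _ = inj₁ (ℚ.*-zeroˡ d)
    term (inj₂ _) d u (inj₁ refl) = inj₁ (ℚ.*-zeroʳ c)
    term (inj₂ w<1+n) d u (inj₂ e) = inj₂ (subst (ℕ._≤ n) (sym e) (ℕ.≤-pred w<1+n))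

  WeightBelow-zero : ∀ X → WeightBelow 0 X → X ≈ []
  WeightBelow-zero [] [] = ≈-refl
  WeightBelow-zero ((c , w) ∷ X) (inj₁ refl ∷ bX) = ≈-trans (zero-term w X) (WeightBelow-zero X bX)

  weightBound : Comb IWord → ℕ
  weightBound [] = 0
  weightBound ((c , w) ∷ X) = suc (sum w) ℕ.+ weightBound X

  WeightBelow-mono : ∀ {m n} X → m ℕ.≤ n → WeightBelow m X → WeightBelow n X
  WeightBelow-mono [] m≤n [] = []
  WeightBelow-mono (_ ∷ X) m≤n (inj₁ c≡0 ∷ bX) = inj₁ c≡0 ∷ WeightBelow-mono X m≤n bX
  WeightBelow-mono (_ ∷ X) m≤n (inj₂ lt ∷ bX) = inj₂ (ℕ.<-≤-trans lt m≤n) ∷ WeightBelow-mono X m≤n bX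

  WeightBelow-weightBound : ∀ X → WeightBelow (weightBound X) X
  WeightBelow-weightBound [] = []
  WeightBelow-weightBound ((c , w) ∷ X) = inj₂ (ℕ.m≤m+n (suc (sum w)) (weightBound X))
    ∷ WeightBelow-mono X (ℕ.m≤n+m (weightBound X) (suc (sum w))) (WeightBelow-weightBound X)

  lowerₗ-nilpotent : ∀ n X → WeightBelow n X → fold X lowerₗ n ≈ []
  lowerₗ-nilpotent n X bX = ≈-trans (≡⇒≈ (iterate-is-fold X lowerₗ n)) (iterate-vanishes n X bX)
    where
    iterate-vanishes : ∀ n X → WeightBelow n X → iterate lowerₗ X n ≈ []
    iterate-vanishes zero X bX = WeightBelow-zero X bX
    iterate-vanishes (suc n) X bX = iterate-vanishes n (lowerₗ X) (WeightBelow-lowerₗ n X bX)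

  Decomposable-unscale : ∀ c {X} → ¬ c ≡ 0ℚ → Decomposable (c · X) → Decomposable X
  Decomposable-unscale c {X} c≢0 dcX = Decomposable-resp X≈ (Decomposable-· (1/ c) dcX)
    where
    instance _ = ℚ.≢-nonZero c≢0
    X≈ : X ≈ (1/ c) · c · X
    X≈ = ≈-sym (≈-trans (·-assoc (1/ c) c X) (≈-trans (≡⇒≈ (cong (_· X) (ℚ.*-inverseˡ c))) (·-identityˡ X)))

  scaleByLength-preserves-Decomposable : ∀ g {X} → Decomposable X → Decomposable (scaleByLength g X)
  scaleByLength-preserves-Decomposable g = linear-preserves-Decomposable _ λ {a} {b} na nb →
    Decomposable-resp (scaleByLength-homogeneous g _ (a ⧢ b) (⧢-homogeneous a b))
      (Decomposable-· (g (length a ℕ.+ length b)) (Decomposable-⧢ na nb))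

  -- 1/n on lengths of non-empty words; the value at 0 is never used.
  recipFromℕ : ℕ → ℚ
  recipFromℕ zero = 0ℚ
  recipFromℕ (suc n) = 1/ fromℕ (suc n)
    where instance _ = ℚ.≢-nonZero (fromℕ-suc≢0 n)

  scaleByLength-recip-countₗ : ∀ X → AllWords NonEmpty X → scaleByLength recipFromℕ (countₗ X) ≈ X
  scaleByLength-recip-countₗ X nX = begin
    scaleByLength recipFromℕ (countₗ X)                           ≈⟨ linear-∘ count _ X ⟩
    linear (λ v → scaleByLength recipFromℕ (count v)) X           ≈⟨ linear-cong-on X nX inverse ⟩
    linear basis X                                                ≈⟨ linear-basis-id X ⟩
    X                                                             ∎
    where
    inverse : ∀ w → NonEmpty w → scaleByLength recipFromℕ (count w) ≈ basis w
    inverse w@(k ∷ u) nonEmpty = begin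
      scaleByLength recipFromℕ (count w)
        ≈⟨ linear-resp byLength (count≈length· w) ⟩
      scaleByLength recipFromℕ (fromℕ (length w) · basis w)
        ≈⟨ linear-·-basis byLength (fromℕ (length w)) w ⟩
      fromℕ (length w) · recipFromℕ (length w) · basis w
        ≈⟨ ·-assoc (fromℕ (length w)) (recipFromℕ (length w)) (basis w) ⟩
      (fromℕ (length w) * recipFromℕ (length w)) · basis w
        ≡⟨ cong (_· basis w) (ℚ.*-inverseʳ (fromℕ (length w))) ⟩
      1ℚ · basis w
        ≈⟨ ·-identityˡ (basis w) ⟩
      basis w
        ∎
      where
      byLength : IWord → Comb IWord
      byLength v = recipFromℕ (length v) · basis v
      instance _ = ℚ.≢-nonZero (fromℕ-suc≢0 (length u))

  countₗ-reflects-Decomposable : ∀ X → AllWords NonEmpty X → Decomposable (countₗ X) → Decomposable X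
  countₗ-reflects-Decomposable X nX dNX =
    Decomposable-resp (≈-sym (scaleByLength-recip-countₗ X nX)) (scaleByLength-preserves-Decomposable recipFromℕ dNX)

  lowerₗ-iterate-raiseₗ : ∀ j X → fold (raiseₗ X) lowerₗ (suc j) ≈
                          raiseₗ (fold X lowerₗ (suc j)) ++ fromℕ (suc j) · countₗ (fold X lowerₗ j)
  lowerₗ-iterate-raiseₗ zero X = ≈-trans (lowerₗ-raiseₗ X)
    (++-cong ≈-refl (≈-sym (≈-trans (≡⇒≈ (cong (_· countₗ X) (ℚ.+-identityʳ 1ℚ))) (·-identityˡ (countₗ X)))))
  lowerₗ-iterate-raiseₗ (suc j) X = begin
    lowerₗ (fold (raiseₗ X) lowerₗ (suc j))
      ≈⟨ linear-resp lower (lowerₗ-iterate-raiseₗ j X) ⟩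
    lowerₗ (raiseₗ Y₁ ++ c · countₗ Y₀)
      ≡⟨ linear-++ lower (raiseₗ Y₁) (c · countₗ Y₀) ⟩
    lowerₗ (raiseₗ Y₁) ++ lowerₗ (c · countₗ Y₀)
      ≈⟨ ++-cong (lowerₗ-raiseₗ Y₁) (≈-trans (linear-· lower c (countₗ Y₀)) (·-cong c (lowerₗ-countₗ Y₀))) ⟩
    (raiseₗ (lowerₗ Y₁) ++ countₗ Y₁) ++ c · countₗ Y₁
      ≈⟨ ++-assoc (raiseₗ (lowerₗ Y₁)) (countₗ Y₁) (c · countₗ Y₁) ⟩
    raiseₗ (lowerₗ Y₁) ++ countₗ Y₁ ++ c · countₗ Y₁
      ≈⟨ ++-cong (≈-refl {raiseₗ (lowerₗ Y₁)}) (≈-trans (++-cong (≈-sym (·-identityˡ (countₗ Y₁))) ≈-refl)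
                                                         (≈-sym (·-distribʳ 1ℚ c (countₗ Y₁)))) ⟩
    raiseₗ (lowerₗ Y₁) ++ fromℕ (suc (suc j)) · countₗ Y₁
      ∎
    where
    Y₀ Y₁ : Comb IWord
    Y₀ = fold X lowerₗ j
    Y₁ = lowerₗ Y₀
    c : ℚ
    c = fromℕ (suc j)

  raiseₗ-reflects-Decomposable : ∀ X → AllWords NonEmpty X → Decomposable (raiseₗ X) → Decomposable X
  raiseₗ-reflects-Decomposable X nX dDX = descend (weightBound X) 0 (WeightBelow-weightBound X)
    where
    nonEmpty-iterate : ∀ i → AllWords NonEmpty (fold X lowerₗ i)
    nonEmpty-iterate zero = nX
    nonEmpty-iterate (suc i) = AllWords-linear lower _ (nonEmpty-iterate i) (∂-nonEmpty lowerCoef ℕ.pred)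
    decomposable-iterate : ∀ i → Decomposable (fold (raiseₗ X) lowerₗ i)
    decomposable-iterate zero = dDX
    decomposable-iterate (suc i) = ∂ₗ-preserves-Decomposable lowerCoef ℕ.pred (decomposable-iterate i)
    -- Downward induction on i: the lowering operator kills X after weightBound X steps, and the
    -- commutation relation recovers countₗ (lowerⁱ X) from lowerⁱ⁺¹ X.
    descend : ∀ k i → WeightBelow (i ℕ.+ k) X → Decomposable (fold X lowerₗ i)
    descend zero i bX = Decomposable-resp (lowerₗ-nilpotent i X (subst (λ n → WeightBelow n X) (ℕ.+-identityʳ i) bX))
                                          Decomposable-[]
    descend (suc k) i bX = countₗ-reflects-Decomposable _ (nonEmpty-iterate i)
      (Decomposable-unscale (fromℕ (suc i)) (fromℕ-suc≢0 i)
        (Decomposable-cancelˡ (raiseₗ (fold X lowerₗ (suc i))) _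
          (Decomposable-resp (≈-sym (lowerₗ-iterate-raiseₗ i X)) (decomposable-iterate (suc i)))
          (∂ₗ-preserves-Decomposable (λ k → fromℕ (suc k)) suc
            (descend k (suc i) (subst (λ n → WeightBelow n X) (ℕ.+-suc i k) bX)))))

  -- The antipode

  append : ℕ → Comb IWord → Comb IWord
  append k = relabel (_∷ʳ k)

  append-prepend : ∀ l m X → append l (prepend m X) ≡ prepend m (append l X)
  append-prepend l m X = trans (relabel-∘ _ _ X) (sym (relabel-∘ _ _ X))

  ⧢-∷ʳ : ∀ a b k l → (a ∷ʳ k) ⧢ (b ∷ʳ l) ≈ append k (a ⧢ (b ∷ʳ l)) ++ append l ((a ∷ʳ k) ⧢ b)
  ⧢-∷ʳ [] [] k l = ++-comm (basis (k ∷ l ∷ [])) (basis (l ∷ k ∷ []))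
  ⧢-∷ʳ [] (m ∷ b) k l = begin
    basis (k ∷ m ∷ b ∷ʳ l) ++ prepend m ((k ∷ []) ⧢ (b ∷ʳ l))
      ≈⟨ ++-cong (≈-refl {P₁}) (prepend-resp m (⧢-∷ʳ [] b k l)) ⟩
    P₁ ++ prepend m (append k (basis (b ∷ʳ l)) ++ append l ((k ∷ []) ⧢ b))
      ≡⟨ cong (P₁ ++_) (relabel-++ (m ∷_) (append k (basis (b ∷ʳ l))) _) ⟩
    P₁ ++ P₂ ++ P₃
      ≈⟨ ++-solve 3 (λ p₁ p₂ p₃ → p₁ ⊕ (p₂ ⊕ p₃) ⊜ p₂ ⊕ (p₁ ⊕ p₃)) ≈-refl P₁ P₂ P₃ ⟩
    P₂ ++ P₁ ++ P₃
      ≡⟨ cong (λ X → P₂ ++ X) (trans (relabel-++ (_∷ʳ l) (basis (k ∷ m ∷ b)) _) (cong (P₁ ++_) (append-prepend l m ((k ∷ []) ⧢ b)))) ⟨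
    append k (basis (m ∷ b ∷ʳ l)) ++ append l ((k ∷ []) ⧢ (m ∷ b))
      ∎
    where
    P₁ P₂ P₃ : Comb IWord
    P₁ = basis (k ∷ m ∷ b ∷ʳ l)
    P₂ = prepend m (append k (basis (b ∷ʳ l)))
    P₃ = prepend m (append l ((k ∷ []) ⧢ b))
  ⧢-∷ʳ (n ∷ a) [] k l = begin
    prepend n ((a ∷ʳ k) ⧢ (l ∷ [])) ++ basis (l ∷ n ∷ a ∷ʳ k)
      ≈⟨ ++-cong (prepend-resp n (⧢-∷ʳ a [] k l)) (≈-refl {R₃}) ⟩
    prepend n (append k (a ⧢ (l ∷ [])) ++ append l ((a ∷ʳ k) ⧢ [])) ++ R₃
      ≡⟨ cong (_++ R₃) (trans (relabel-++ (n ∷_) (append k (a ⧢ (l ∷ []))) _)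
                              (cong (λ X → R₁ ++ prepend n (append l X)) (⧢-identityʳ (a ∷ʳ k)))) ⟩
    (R₁ ++ R₂) ++ R₃
      ≈⟨ ++-solve 3 (λ r₁ r₂ r₃ → (r₁ ⊕ r₂) ⊕ r₃ ⊜ (r₁ ⊕ r₃) ⊕ r₂) ≈-refl R₁ R₂ R₃ ⟩
    (R₁ ++ R₃) ++ R₂
      ≡⟨ cong (_++ R₂) (trans (relabel-++ (_∷ʳ k) (prepend n (a ⧢ (l ∷ []))) _) (cong (_++ R₃) (append-prepend k n (a ⧢ (l ∷ []))))) ⟨
    append k ((n ∷ a) ⧢ (l ∷ [])) ++ append l (basis (n ∷ a ∷ʳ k))
      ∎
    where
    R₁ R₂ R₃ : Comb IWord
    R₁ = prepend n (append k (a ⧢ (l ∷ [])))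
    R₂ = basis (n ∷ (a ∷ʳ k) ∷ʳ l)
    R₃ = basis (l ∷ n ∷ a ∷ʳ k)
  ⧢-∷ʳ (n ∷ a) (m ∷ b) k l = begin
    prepend n ((a ∷ʳ k) ⧢ (m ∷ b ∷ʳ l)) ++ prepend m ((n ∷ a ∷ʳ k) ⧢ (b ∷ʳ l))
      ≈⟨ ++-cong (prepend-resp n (⧢-∷ʳ a (m ∷ b) k l)) (prepend-resp m (⧢-∷ʳ (n ∷ a) b k l)) ⟩
    prepend n (append k (a ⧢ (m ∷ b ∷ʳ l)) ++ append l ((a ∷ʳ k) ⧢ (m ∷ b)))
      ++ prepend m (append k ((n ∷ a) ⧢ (b ∷ʳ l)) ++ append l ((n ∷ a ∷ʳ k) ⧢ b))
      ≡⟨ cong₂ _++_ (relabel-++ (n ∷_) (append k (a ⧢ (m ∷ b ∷ʳ l))) _) (relabel-++ (m ∷_) (append k ((n ∷ a) ⧢ (b ∷ʳ l))) _) ⟩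
    (U₁ ++ U₂) ++ (U₃ ++ U₄)
      ≈⟨ ++-solve 4 (λ u₁ u₂ u₃ u₄ → (u₁ ⊕ u₂) ⊕ (u₃ ⊕ u₄) ⊜ (u₁ ⊕ u₃) ⊕ (u₂ ⊕ u₄)) ≈-refl U₁ U₂ U₃ U₄ ⟩
    (U₁ ++ U₃) ++ (U₂ ++ U₄)
      ≡⟨ cong₂ _++_
           (trans (relabel-++ (_∷ʳ k) (prepend n (a ⧢ (m ∷ b ∷ʳ l))) _) (cong₂ _++_ (append-prepend k n (a ⧢ (m ∷ b ∷ʳ l))) (append-prepend k m ((n ∷ a) ⧢ (b ∷ʳ l)))))
           (trans (relabel-++ (_∷ʳ l) (prepend n ((a ∷ʳ k) ⧢ (m ∷ b))) _) (cong₂ _++_ (append-prepend l n ((a ∷ʳ k) ⧢ (m ∷ b))) (append-prepend l m ((n ∷ a ∷ʳ k) ⧢ b)))) ⟨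
    append k ((n ∷ a) ⧢ (m ∷ b ∷ʳ l)) ++ append l ((n ∷ a ∷ʳ k) ⧢ (m ∷ b))
      ∎
    where
    U₁ U₂ U₃ U₄ : Comb IWord
    U₁ = prepend n (append k (a ⧢ (m ∷ b ∷ʳ l)))
    U₂ = prepend n (append l ((a ∷ʳ k) ⧢ (m ∷ b)))
    U₃ = prepend m (append k ((n ∷ a) ⧢ (b ∷ʳ l)))
    U₄ = prepend m (append l ((n ∷ a ∷ʳ k) ⧢ b))

  reverse-prepend : ∀ k X → relabel reverse (prepend k X) ≡ append k (relabel reverse X)
  reverse-prepend k X = trans (relabel-∘ reverse (k ∷_) X)
    (trans (relabel-cong (List.unfold-reverse k) X) (sym (relabel-∘ (_∷ʳ k) reverse X)))

  reverse-⧢ : ∀ a b → relabel reverse (a ⧢ b) ≈ reverse a ⧢ reverse b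
  reverse-⧢ [] b = ≈-refl
  reverse-⧢ (k ∷ a) [] = ≡⇒≈ (sym (⧢-identityʳ (reverse (k ∷ a))))
  reverse-⧢ (k ∷ a) (l ∷ b) = begin
    relabel reverse (prepend k (a ⧢ (l ∷ b)) ++ prepend l ((k ∷ a) ⧢ b))
      ≡⟨ trans (relabel-++ reverse (prepend k (a ⧢ (l ∷ b))) _)
               (cong₂ _++_ (reverse-prepend k (a ⧢ (l ∷ b))) (reverse-prepend l ((k ∷ a) ⧢ b))) ⟩
    append k (relabel reverse (a ⧢ (l ∷ b))) ++ append l (relabel reverse ((k ∷ a) ⧢ b))
      ≈⟨ ++-cong (relabel-resp (_∷ʳ k) (reverse-⧢ a (l ∷ b))) (relabel-resp (_∷ʳ l) (reverse-⧢ (k ∷ a) b)) ⟩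
    append k (reverse a ⧢ reverse (l ∷ b)) ++ append l (reverse (k ∷ a) ⧢ reverse b)
      ≡⟨ cong₂ (λ u v → append k (reverse a ⧢ u) ++ append l (v ⧢ reverse b)) (List.unfold-reverse l b) (List.unfold-reverse k a) ⟩
    append k (reverse a ⧢ (reverse b ∷ʳ l)) ++ append l ((reverse a ∷ʳ k) ⧢ reverse b)
      ≈⟨ ⧢-∷ʳ (reverse a) (reverse b) k l ⟨
    (reverse a ∷ʳ k) ⧢ (reverse b ∷ʳ l)
      ≡⟨ cong₂ _⧢_ (List.unfold-reverse k a) (List.unfold-reverse l b) ⟨
    reverse (k ∷ a) ⧢ reverse (l ∷ b)
      ∎

  sgn-involutive : ∀ n → sgn n * sgn n ≡ 1ℚ
  sgn-involutive zero = refl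
  sgn-involutive (suc n) = trans (solve 1 (λ s → (:- s) :* (:- s) := s :* s) refl (sgn n)) (sgn-involutive n)

  antipode : IWord → Comb IWord
  antipode v = (sgn (length v) , reverse v) ∷ []

  antipodeₗ : Comb IWord → Comb IWord
  antipodeₗ = linear antipode

  antipodeₗ-involutive : ∀ X → antipodeₗ (antipodeₗ X) ≈ X
  antipodeₗ-involutive X = ≈-trans (linear-∘ antipode antipode X) (≈-trans (linear-cong twice X) (linear-basis-id X))
    where
    twice : ∀ v → antipodeₗ (antipode v) ≈ basis v
    twice v = ≈-trans (++-identityʳ _) (≡⇒≈ (cong₂ (λ c w → (c , w) ∷ [])
      (trans (cong (λ n → sgn (length v) * sgn n) (List.length-reverse v)) (sgn-involutive (length v)))
      (List.reverse-involutive v)))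

  NonEmpty-reverse : ∀ {a} → NonEmpty a → NonEmpty (reverse a)
  NonEmpty-reverse {a} nonEmpty = length≡suc⇒NonEmpty (reverse a) (List.length-reverse a)

  antipodeₗ-preserves-Decomposable : ∀ {X} → Decomposable X → Decomposable (antipodeₗ X)
  antipodeₗ-preserves-Decomposable = linear-preserves-Decomposable antipode λ {a} {b} na nb →
    Decomposable-resp (image a b) (Decomposable-· (sgn (length a ℕ.+ length b)) (Decomposable-⧢ (NonEmpty-reverse na) (NonEmpty-reverse nb)))
    where
    image : ∀ a b → antipodeₗ (a ⧢ b) ≈ sgn (length a ℕ.+ length b) · (reverse a ⧢ reverse b)
    image a b = begin
      antipodeₗ (a ⧢ b)
        ≈⟨ linear-cong-on (a ⧢ b) (⧢-homogeneous a b)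
             (λ v |v|≡n → ≈-trans (single≈·basis _ (reverse v)) (≡⇒≈ (cong (λ m → sgn m · basis (reverse v)) |v|≡n))) ⟩
      linear (λ v → s · basis (reverse v)) (a ⧢ b)
        ≈⟨ linear-·ᶠ s (λ v → basis (reverse v)) (a ⧢ b) ⟩
      s · linear (λ v → basis (reverse v)) (a ⧢ b)
        ≈⟨ ·-cong s (≈-trans (linear-basis-relabel reverse (a ⧢ b)) (reverse-⧢ a b)) ⟩
      s · (reverse a ⧢ reverse b)
        ∎
      where
      s : ℚ
      s = sgn (length a ℕ.+ length b)

  -- ψ̄ in index coordinates

  ψ̄-term : IWord → ℕ → Comb IWord
  ψ̄-term ks i = sgn (length ks ∸ i) · (take i ks ⧢ᵣ raise (reverse (drop i ks)))

  ψ̄ᵢ : IWord → Comb IWord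
  ψ̄ᵢ ks = concat (map (ψ̄-term ks) (upTo (length ks)))

  antipodeₗ-raiseₗ : ∀ X → raiseₗ (antipodeₗ X) ≈ linear (λ ks → sgn (length ks) · raise (reverse ks)) X
  antipodeₗ-raiseₗ X = ≈-trans (linear-∘ antipode raise X) (linear-cong (λ v → ++-identityʳ _) X)

  Decomposable-concat : ∀ Xs → All Decomposable Xs → Decomposable (concat Xs)
  Decomposable-concat [] [] = Decomposable-[]
  Decomposable-concat (X ∷ Xs) (dX ∷ dXs) = Decomposable-++ dX (Decomposable-concat Xs dXs)

  NonEmpty-drop : ∀ {i} ks → i ℕ.< length ks → NonEmpty (drop i ks)
  NonEmpty-drop {zero} (k ∷ ks) _ = nonEmpty
  NonEmpty-drop {suc i} (k ∷ ks) (ℕ.s≤s i<n) = NonEmpty-drop ks i<n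

  ψ̄ᵢ-tail : IWord → Comb IWord
  ψ̄ᵢ-tail [] = []
  ψ̄ᵢ-tail ks@(_ ∷ ks′) = concat (map (ψ̄-term ks) (applyUpTo suc (length ks′)))

  ψ̄ᵢ-split : ∀ ks → NonEmpty ks → ψ̄ᵢ ks ≈ sgn (length ks) · raise (reverse ks) ++ ψ̄ᵢ-tail ks
  ψ̄ᵢ-split ks@(_ ∷ _) nonEmpty = ++-cong (·-cong (sgn (length ks)) (linear-basis-id (raise (reverse ks)))) ≈-refl

  ψ̄ᵢ-tail-Decomposable : ∀ ks → NonEmpty ks → Decomposable (ψ̄ᵢ-tail ks)
  ψ̄ᵢ-tail-Decomposable ks@(k ∷ ks′) nonEmpty = Decomposable-concat _ (All.map⁺ (All.applyUpTo⁺₁ suc (length ks′) term))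
    where
    term : ∀ {i} → i ℕ.< length ks′ → Decomposable (ψ̄-term ks (suc i))
    term {i} i<n = Decomposable-· (sgn (length ks′ ∸ i)) (⧢ᵣ-Decomposable _ nonEmpty
      (∂-nonEmpty _ suc (reverse (drop i ks′)) (NonEmpty-reverse (NonEmpty-drop ks′ i<n))))

  -- The summand i = 0 of ψ̄ᵢ is raise ∘ antipode; all the others are decomposable.
  ker-ψ̄ᵢ-Decomposable : ∀ X → AllWords NonEmpty X → linear ψ̄ᵢ X ≈ [] → Decomposable X
  ker-ψ̄ᵢ-Decomposable X nX ψ̄X≈0 =
    Decomposable-resp (≈-sym (antipodeₗ-involutive X)) (antipodeₗ-preserves-Decomposable
      (raiseₗ-reflects-Decomposable (antipodeₗ X) (AllWords-linear antipode X nX (λ v nv → NonEmpty-reverse nv ∷ []))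
        (Decomposable-cancelˡ (linear ψ̄ᵢ-tail X) _ (Decomposable-resp split Decomposable-[]) tail-Decomposable)))
    where
    tail-Decomposable : Decomposable (linear ψ̄ᵢ-tail X)
    tail-Decomposable = Decomposable-linear ψ̄ᵢ-tail X (All.map (ψ̄ᵢ-tail-Decomposable _) nX)
    split : linear ψ̄ᵢ-tail X ++ raiseₗ (antipodeₗ X) ≈ []
    split = begin
      linear ψ̄ᵢ-tail X ++ raiseₗ (antipodeₗ X)
        ≈⟨ ++-comm (linear ψ̄ᵢ-tail X) (raiseₗ (antipodeₗ X)) ⟩
      raiseₗ (antipodeₗ X) ++ linear ψ̄ᵢ-tail X
        ≈⟨ ++-cong (antipodeₗ-raiseₗ X) ≈-refl ⟩
      linear (λ ks → sgn (length ks) · raise (reverse ks)) X ++ linear ψ̄ᵢ-tail X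
        ≈⟨ linear-++ᶠ _ ψ̄ᵢ-tail X ⟨
      linear (λ ks → sgn (length ks) · raise (reverse ks) ++ ψ̄ᵢ-tail ks) X
        ≈⟨ linear-cong-on X nX (λ ks nks → ≈-sym (ψ̄ᵢ-split ks nks)) ⟩
      linear ψ̄ᵢ X
        ≈⟨ ψ̄X≈0 ⟩
      []
        ∎

-- Back to words in x and y

open IndexWords

module W = FormalSum _≟W_
module WordMap = LinearMap _≟W_ _≟W_
open import Relation.Binary.Reasoning.Setoid W.setoid

coeff≡coef : ∀ w p → coeff w p ≡ W.coef w p
coeff≡coef w [] = refl
coeff≡coef w ((c , v) ∷ p) with v ≟W w
... | yes _ = cong (c +_) (coeff≡coef w p)
... | no _ = coeff≡coef w p

≈P⇒≈ : ∀ {p q} → p ≈P q → p W.≈ q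
≈P⇒≈ {p} {q} p≈q = W.mk≈ λ w → trans (sym (coeff≡coef w p)) (trans (p≈q w) (coeff≡coef w q))

≈⇒≈P : ∀ {p q} → p W.≈ q → p ≈P q
≈⇒≈P {p} {q} p≈q w = trans (coeff≡coef w p) (trans (W.coef-≡ p≈q w) (sym (coeff≡coef w q)))

scale≡· : ∀ c p → scale c p ≡ c · p
scale≡· c [] = refl
scale≡· c ((d , v) ∷ p) = cong ((c * d , v) ∷_) (scale≡· c p)

prefix≡relabel : ∀ u p → prefix u p ≡ relabel (u ++_) p
prefix≡relabel u [] = refl
prefix≡relabel u ((d , v) ∷ p) = cong ((d , u ++ v) ∷_) (prefix≡relabel u p)

linExt≡linear : ∀ f p → linExt f p ≡ linear f p
linExt≡linear f [] = refl
linExt≡linear f ((c , v) ∷ p) = cong₂ _++_ (scale≡· c (f v)) (linExt≡linear f p)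

zword : IWord → Word
zword ks = zs (map suc ks)

-- decomp with the z-indices shifted down by one, matching the index coordinates.
zIndices : Word → ℕ × IWord
zIndices [] = (0 , [])
zIndices (x ∷ w) = (suc (proj₁ (zIndices w)) , proj₂ (zIndices w))
zIndices (y ∷ w) = (0 , proj₁ (zIndices w) ∷ proj₂ (zIndices w))

zIndices-correct : ∀ w → w ≡ replicate (proj₁ (zIndices w)) x ++ zword (proj₂ (zIndices w))
zIndices-correct [] = refl
zIndices-correct (x ∷ w) = cong (x ∷_) (zIndices-correct w)
zIndices-correct (y ∷ w) = cong (y ∷_) (zIndices-correct w)

zIndices-zword : ∀ n ks → zIndices (replicate n x ++ zword ks) ≡ (n , ks)
zIndices-zword (suc n) ks = cong (λ p → (suc (proj₁ p) , proj₂ p)) (zIndices-zword n ks)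
zIndices-zword zero [] = refl
zIndices-zword zero (k ∷ ks) = cong (λ p → (0 , proj₁ p ∷ proj₂ p)) (zIndices-zword k ks)

zword-injective : ∀ {as bs} → zword as ≡ zword bs → as ≡ bs
zword-injective {as} {bs} e = cong proj₂ (trans (sym (zIndices-zword 0 as)) (trans (cong zIndices e) (zIndices-zword 0 bs)))

decomp≡zIndices : ∀ w → decomp w ≡ (proj₁ (zIndices w) , map suc (proj₂ (zIndices w)))
decomp≡zIndices [] = refl
decomp≡zIndices (x ∷ w) = cong (λ p → (suc (proj₁ p) , proj₂ p)) (decomp≡zIndices w)
decomp≡zIndices (y ∷ w) = cong (λ p → (0 , suc (proj₁ p) ∷ proj₂ p)) (decomp≡zIndices w)

parse-zword : ∀ ks → parse (zword ks) ≡ map suc ks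
parse-zword ks = trans (cong proj₂ (decomp≡zIndices (zword ks))) (cong (λ p → map suc (proj₂ p)) (zIndices-zword 0 ks))

embed : Comb IWord → Poly
embed = relabel zword

embed-resp : ∀ {X Y} → X ≈ Y → embed X W.≈ embed Y
embed-resp = LinearMap.relabel-resp _≟ᵢ_ _≟W_ zword

embed-reflects : ∀ {X Y} → embed X W.≈ embed Y → X ≈ Y
embed-reflects = LinearMap.relabel-reflects _≟ᵢ_ _≟W_ zword zword-injective

embed-prepend : ∀ k X → embed (prepend k X) ≡ relabel ((y ∷ replicate k x) ++_) (embed X)
embed-prepend k X = trans (relabel-∘ zword (k ∷_) X) (sym (relabel-∘ _ zword X))

σ₁-zword : ∀ ks → σ 1 (zword ks) W.≈ embed (raise ks)

sh-x : ∀ k r → sh (replicate k x ++ zword r) (x ∷ []) W.≈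
       fromℕ (suc k) · basis (x ∷ replicate k x ++ zword r) ++ relabel (replicate k x ++_) (embed (raise r))
sh-x zero [] = W.≈-sym (W.≈-trans (W.++-identityʳ _) (W.≈-trans (W.≡⇒≈ (cong (_· basis (x ∷ [])) (ℚ.+-identityʳ 1ℚ))) (W.·-identityˡ _)))
sh-x zero (j ∷ r) = begin
  σ 1 (zword (j ∷ r)) ++ C                     ≈⟨ W.++-cong (σ₁-zword (j ∷ r)) (W.≈-refl {C}) ⟩
  embed (raise (j ∷ r)) ++ C                   ≈⟨ W.++-comm _ C ⟩
  C ++ embed (raise (j ∷ r))                   ≈⟨ W.++-cong (W.≈-sym (W.≈-trans (W.≡⇒≈ (cong (_· C) (ℚ.+-identityʳ 1ℚ))) (W.·-identityˡ C))) W.≈-refl ⟩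
  fromℕ 1 · C ++ embed (raise (j ∷ r))         ≡⟨ cong (fromℕ 1 · C ++_) (List.map-id (embed (raise (j ∷ r)))) ⟨
  fromℕ 1 · C ++ relabel ([] ++_) (embed (raise (j ∷ r)))
    ∎
  where
  C : Poly
  C = basis (x ∷ y ∷ replicate j x ++ zword r)
sh-x (suc k) r = begin
  prefix (x ∷ []) (sh (replicate k x ++ zword r) (x ∷ [])) ++ C
    ≡⟨ cong (_++ C) (prefix≡relabel (x ∷ []) _) ⟩
  relabel (x ∷_) (sh (replicate k x ++ zword r) (x ∷ [])) ++ C
    ≈⟨ W.++-cong (WordMap.relabel-resp (x ∷_) (sh-x k r)) (W.≈-refl {C}) ⟩
  relabel (x ∷_) (fromℕ (suc k) · basis (x ∷ replicate k x ++ zword r) ++ relabel (replicate k x ++_) (embed (raise r))) ++ C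
    ≡⟨ cong (_++ C) (trans (relabel-++ (x ∷_) (fromℕ (suc k) · basis _) _) (cong (A ++_) (relabel-∘ (x ∷_) _ (embed (raise r))))) ⟩
  (A ++ B) ++ C
    ≈⟨ W.++-solve 3 (λ a b c → (a W.⊕ b) W.⊕ c W.⊜ (c W.⊕ a) W.⊕ b) W.≈-refl A B C ⟩
  (C ++ A) ++ B
    ≈⟨ W.++-cong (W.≈-trans (W.++-cong (W.≈-sym (W.·-identityˡ C)) (W.≈-refl {A})) (W.≈-sym (W.·-distribʳ 1ℚ (fromℕ (suc k)) C)))
                 (W.≈-refl {B}) ⟩
  fromℕ (suc (suc k)) · C ++ B
    ∎
  where
  C A B : Poly
  C = basis (x ∷ x ∷ replicate k x ++ zword r)
  A = fromℕ (suc k) · C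
  B = relabel ((x ∷ replicate k x) ++_) (embed (raise r))

σ₁-zword [] = W.≈-refl
σ₁-zword (k ∷ r) = begin
  prefix (y ∷ []) (sh (replicate k x ++ zword r) (x ∷ []))
    ≡⟨ prefix≡relabel (y ∷ []) _ ⟩
  relabel (y ∷_) (sh (replicate k x ++ zword r) (x ∷ []))
    ≈⟨ WordMap.relabel-resp (y ∷_) (sh-x k r) ⟩
  relabel (y ∷_) (fromℕ (suc k) · basis (x ∷ replicate k x ++ zword r) ++ relabel (replicate k x ++_) (embed (raise r)))
    ≡⟨ trans (relabel-++ (y ∷_) (fromℕ (suc k) · basis _) _) (cong (A ++_) (relabel-∘ (y ∷_) _ (embed (raise r)))) ⟩
  A ++ relabel ((y ∷ replicate k x) ++_) (embed (raise r))
    ≈⟨ W.++-cong (W.≈-sym (W.single≈·basis (fromℕ (suc k)) _)) (W.≡⇒≈ (sym (embed-prepend k (raise r)))) ⟩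
  embed (raise (k ∷ r))
    ∎
  where
  A : Poly
  A = fromℕ (suc k) · basis (y ∷ x ∷ replicate k x ++ zword r)

tshZ-zword : ∀ as bs → tshZ (map suc as) (map suc bs) ≡ embed (as ⧢ bs)
tshZ-zword [] bs = refl
tshZ-zword (k ∷ as) [] = refl
tshZ-zword (k ∷ as) (l ∷ bs) = trans
  (cong₂ _++_ (trans (prefix≡relabel (z (suc k)) _) (cong (relabel (z (suc k) ++_)) (tshZ-zword as (l ∷ bs))))
              (trans (prefix≡relabel (z (suc l)) _) (cong (relabel (z (suc l) ++_)) (tshZ-zword (k ∷ as) bs))))
  (sym (trans (relabel-++ zword (prepend k (as ⧢ (l ∷ bs))) _)
              (cong₂ _++_ (embed-prepend k (as ⧢ (l ∷ bs))) (embed-prepend l ((k ∷ as) ⧢ bs)))))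

tsh-oneW : ∀ u q → tsh (oneW u) q W.≈ linear (λ v → tshZ (parse u) (parse v)) q
tsh-oneW u [] = W.≈-refl
tsh-oneW u ((d , v) ∷ q) = W.≈-trans (W.≡⇒≈ (List.++-assoc (scale (1ℚ * d) (tshZ (parse u) (parse v))) _ []))
  (W.++-cong (W.≡⇒≈ (trans (scale≡· (1ℚ * d) _) (cong (_· tshZ (parse u) (parse v)) (ℚ.*-identityˡ d)))) (tsh-oneW u q))

tsh-zword-embed : ∀ as Q → tsh (oneW (zword as)) (embed Q) W.≈ embed (as ⧢ᵣ Q)
tsh-zword-embed as Q = begin
  tsh (oneW (zword as)) (embed Q)
    ≈⟨ tsh-oneW (zword as) (embed Q) ⟩
  linear (λ v → tshZ (parse (zword as)) (parse v)) (embed Q)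
    ≡⟨ linear-relabel _ zword Q ⟩
  linear (λ v → tshZ (parse (zword as)) (parse (zword v))) Q
    ≈⟨ W.linear-cong (λ v → W.≡⇒≈ (trans (cong₂ tshZ (parse-zword as) (parse-zword v)) (tshZ-zword as v))) Q ⟩
  linear (λ v → embed (as ⧢ v)) Q
    ≡⟨ relabel-linear zword (as ⧢_) Q ⟨
  embed (as ⧢ᵣ Q)
    ∎

-- The summand of ψ̄W as a function of the index list, so that it can be rewritten along parse-zword.
ψ̄W-term : List ℕ → ℕ → Poly
ψ̄W-term ks i = scale (sgn (length ks ∸ i)) (tsh (oneW (zs (take i ks))) (σ 1 (zs (reverse (drop i ks)))))

tsh-oneW-resp : ∀ u {P Q} → P W.≈ Q → tsh (oneW u) P W.≈ tsh (oneW u) Q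
tsh-oneW-resp u {P} {Q} P≈Q =
  W.≈-trans (tsh-oneW u P) (W.≈-trans (WordMap.linear-resp _ P≈Q) (W.≈-sym (tsh-oneW u Q)))

ψ̄W-term-zword : ∀ ks i → ψ̄W-term (map suc ks) i W.≈ embed (ψ̄-term ks i)
ψ̄W-term-zword ks i = begin
  ψ̄W-term (map suc ks) i
    ≡⟨ trans (cong₃ (λ n as bs → scale (sgn (n ∸ i)) (tsh (oneW (zs as)) (σ 1 (zs bs))))
                    (List.length-map suc ks) (List.take-map i ks)
                    (trans (cong reverse (List.drop-map i ks)) (sym (List.reverse-map suc (drop i ks)))))
             (scale≡· s _) ⟩
  s · tsh (oneW (zword (take i ks))) (σ 1 (zword (reverse (drop i ks))))
    ≈⟨ W.·-cong s (tsh-oneW-resp (zword (take i ks)) (σ₁-zword (reverse (drop i ks)))) ⟩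
  s · tsh (oneW (zword (take i ks))) (embed (raise (reverse (drop i ks))))
    ≈⟨ W.·-cong s (tsh-zword-embed (take i ks) (raise (reverse (drop i ks)))) ⟩
  s · embed (take i ks ⧢ᵣ raise (reverse (drop i ks)))
    ≡⟨ relabel-· zword s _ ⟨
  embed (ψ̄-term ks i)
    ∎
  where
  s : ℚ
  s = sgn (length ks ∸ i)
  cong₃ : ∀ {A B C D : Set} (f : A → B → C → D) {a a′ b b′ c c′} → a ≡ a′ → b ≡ b′ → c ≡ c′ → f a b c ≡ f a′ b′ c′
  cong₃ f refl refl refl = refl

ψ̄W-zword : ∀ ks → ψ̄W (zword ks) W.≈ embed (ψ̄ᵢ ks)
ψ̄W-zword ks = begin
  ψ̄W (zword ks)
    ≡⟨ cong (λ ks′ → sumP (map (ψ̄W-term ks′) (upTo (length ks′)))) (parse-zword ks) ⟩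
  sumP (map (ψ̄W-term (map suc ks)) (upTo (length (map suc ks))))
    ≡⟨ cong (λ n → sumP (map (ψ̄W-term (map suc ks)) (upTo n))) (List.length-map suc ks) ⟩
  sumP (map (ψ̄W-term (map suc ks)) (upTo (length ks)))
    ≈⟨ termwise (upTo (length ks)) ⟩
  embed (ψ̄ᵢ ks)
    ∎
  where
  termwise : ∀ is → sumP (map (ψ̄W-term (map suc ks)) is) W.≈ embed (concat (map (ψ̄-term ks) is))
  termwise [] = W.≈-refl
  termwise (i ∷ is) = W.≈-trans (W.++-cong (ψ̄W-term-zword ks i) (termwise is))
    (W.≡⇒≈ (sym (relabel-++ zword (ψ̄-term ks i) _)))

yTerms : Poly → Poly
yTerms [] = []
yTerms ((c , []) ∷ p) = yTerms p
yTerms ((c , x ∷ w) ∷ p) = yTerms p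
yTerms ((c , y ∷ w) ∷ p) = (c , y ∷ w) ∷ yTerms p

zIndexComb : Poly → Comb IWord
zIndexComb [] = []
zIndexComb ((c , []) ∷ p) = zIndexComb p
zIndexComb ((c , x ∷ w) ∷ p) = zIndexComb p
zIndexComb ((c , y ∷ w) ∷ p) = (c , proj₂ (zIndices (y ∷ w))) ∷ zIndexComb p

embed-zIndexComb : ∀ p → embed (zIndexComb p) ≡ yTerms p
embed-zIndexComb [] = refl
embed-zIndexComb ((c , []) ∷ p) = embed-zIndexComb p
embed-zIndexComb ((c , x ∷ w) ∷ p) = embed-zIndexComb p
embed-zIndexComb ((c , y ∷ w) ∷ p) = cong₂ (λ u q → (c , u) ∷ q) (sym (zIndices-correct (y ∷ w))) (embed-zIndexComb p)

zIndexComb-nonEmpty : ∀ p → AllWords NonEmpty (zIndexComb p)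
zIndexComb-nonEmpty [] = []
zIndexComb-nonEmpty ((c , []) ∷ p) = zIndexComb-nonEmpty p
zIndexComb-nonEmpty ((c , x ∷ w) ∷ p) = zIndexComb-nonEmpty p
zIndexComb-nonEmpty ((c , y ∷ w) ∷ p) = nonEmpty ∷ zIndexComb-nonEmpty p

coef-yTerms-y : ∀ u p → W.coef (y ∷ u) (yTerms p) ≡ W.coef (y ∷ u) p
coef-yTerms-y u [] = refl
coef-yTerms-y u ((c , []) ∷ p) = trans (coef-yTerms-y u p) (sym (W.coef-∷-≢ {[]} c p λ ()))
coef-yTerms-y u ((c , x ∷ w) ∷ p) = trans (coef-yTerms-y u p) (sym (W.coef-∷-≢ {x ∷ w} c p λ ()))
coef-yTerms-y u ((c , y ∷ w) ∷ p) with (y ∷ w) ≟W (y ∷ u)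
... | yes _ = cong (c +_) (coef-yTerms-y u p)
... | no _ = coef-yTerms-y u p

coef-yTerms-¬y : ∀ u → ¬ StartsY u → ∀ p → W.coef u (yTerms p) ≡ 0ℚ
coef-yTerms-¬y u ¬yu [] = refl
coef-yTerms-¬y u ¬yu ((c , []) ∷ p) = coef-yTerms-¬y u ¬yu p
coef-yTerms-¬y u ¬yu ((c , x ∷ w) ∷ p) = coef-yTerms-¬y u ¬yu p
coef-yTerms-¬y u ¬yu ((c , y ∷ w) ∷ p) =
  trans (W.coef-∷-≢ c (yTerms p) (λ e → ¬yu (w , sym e))) (coef-yTerms-¬y u ¬yu p)

InYH⇒≈yTerms : ∀ p → InYH p → p W.≈ yTerms p
InYH⇒≈yTerms p yp = W.mk≈ coef≡
  where
  coef-¬y : ∀ u → ¬ StartsY u → W.coef u p ≡ 0ℚ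
  coef-¬y u ¬yu with coeff u p ℚ.≟ 0ℚ
  ... | yes c≡0 = trans (sym (coeff≡coef u p)) c≡0
  ... | no c≢0 = ⊥-elim (¬yu (yp u c≢0))
  coef≡ : ∀ u → W.coef u p ≡ W.coef u (yTerms p)
  coef≡ [] = trans (coef-¬y [] (λ ())) (sym (coef-yTerms-¬y [] (λ ()) p))
  coef≡ (x ∷ u) = trans (coef-¬y (x ∷ u) (λ ())) (sym (coef-yTerms-¬y (x ∷ u) (λ ()) p))
  coef≡ (y ∷ u) = sym (coef-yTerms-y u p)

InYH⇒≈embed : ∀ p → InYH p → p W.≈ embed (zIndexComb p)
InYH⇒≈embed p yp = W.≈-trans (InYH⇒≈yTerms p yp) (W.≡⇒≈ (sym (embed-zIndexComb p)))

ψ̄-zIndexComb : ∀ p → InYH p → ψ̄ p W.≈ embed (linear ψ̄ᵢ (zIndexComb p))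
ψ̄-zIndexComb p yp = begin
  ψ̄ p                                 ≡⟨ linExt≡linear ψ̄W p ⟩
  linear ψ̄W p                         ≈⟨ WordMap.linear-resp ψ̄W (InYH⇒≈embed p yp) ⟩
  linear ψ̄W (embed X)                 ≡⟨ linear-relabel ψ̄W zword X ⟩
  linear (λ v → ψ̄W (zword v)) X       ≈⟨ W.linear-cong ψ̄W-zword X ⟩
  linear (λ v → embed (ψ̄ᵢ v)) X       ≡⟨ relabel-linear zword ψ̄ᵢ X ⟨
  embed (linear ψ̄ᵢ X)                 ∎
  where
  X = zIndexComb p

InYH-zword : ∀ {as} → NonEmpty as → InYH (oneW (zword as))
InYH-zword {k ∷ as} nonEmpty w c≢0 with zword (k ∷ as) ≟W w
... | yes refl = replicate k x ++ zword as , refl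
... | no _ = ⊥-elim (c≢0 refl)

Decomposable⇒InYHtshYH : ∀ {X} → Decomposable X → InYHtshYH (embed X)
Decomposable⇒InYHtshYH {X} (ts , nts , X≈) =
  map toPolys ts , inYH nts , ≈⇒≈P (W.≈-trans (embed-resp X≈) (embed-shuffleSum ts))
  where
  toPolys : ShuffleTerm → ℚ × Poly × Poly
  toPolys (c , as , bs) = (c , oneW (zword as) , oneW (zword bs))
  inYH : ∀ {ts} → All NonEmptyFactors ts → All (λ t → InYH (proj₁ (proj₂ t)) × InYH (proj₂ (proj₂ t))) (map toPolys ts)
  inYH [] = []
  inYH ((na , nb) ∷ nts) = (InYH-zword na , InYH-zword nb) ∷ inYH nts
  term : ℚ × Poly × Poly → Poly
  term (c , u , v) = scale c (tsh u v)
  embed-shuffleSum : ∀ ts → embed (shuffleSum ts) W.≈ sumP (map term (map toPolys ts))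
  embed-shuffleSum [] = W.≈-refl
  embed-shuffleSum ((c , as , bs) ∷ ts) = begin
    embed (c · (as ⧢ bs) ++ shuffleSum ts)
      ≡⟨ trans (relabel-++ zword (c · (as ⧢ bs)) _) (cong (_++ embed (shuffleSum ts)) (relabel-· zword c (as ⧢ bs))) ⟩
    c · embed (as ⧢ bs) ++ embed (shuffleSum ts)
      ≈⟨ W.++-cong (W.·-cong c (W.≈-sym (W.≈-trans (tsh-zword-embed as (basis bs)) (embed-resp (linear-basis (as ⧢_) bs)))))
                   (embed-shuffleSum ts) ⟩
    c · tsh (oneW (zword as)) (oneW (zword bs)) ++ rest
      ≡⟨ cong (_++ rest) (sym (scale≡· c _)) ⟩
    scale c (tsh (oneW (zword as)) (oneW (zword bs))) ++ rest
      ∎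
    where
    rest : Poly
    rest = sumP (map term (map toPolys ts))

InYHtshYH-resp : ∀ {p q} → p W.≈ q → InYHtshYH q → InYHtshYH p
InYHtshYH-resp p≈q (ts , yts , q≈) = ts , yts , λ w → trans (≈⇒≈P p≈q w) (q≈ w)

lemma9 : (p : Poly) → InYH p → ψ̄ p ≈P zeroP → InYHtshYH p
lemma9 p yp ψ̄p≈0 = InYHtshYH-resp (InYH⇒≈embed p yp)
  (Decomposable⇒InYHtshYH (ker-ψ̄ᵢ-Decomposable X (zIndexComb-nonEmpty p) ψ̄X≈0))
  where
  X : Comb IWord
  X = zIndexComb p
  ψ̄X≈0 : linear ψ̄ᵢ X ≈ []
  ψ̄X≈0 = embed-reflects (W.≈-trans (W.≈-sym (ψ̄-zIndexComb p yp)) (≈P⇒≈ ψ̄p≈0))
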